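{- Let $X$ be a finite alphabet with at least two letters and $k\ge2$. On $\mathcal{R}_k$ the relation $\leq_{CA}$ coincides with $\leq_{DA}$, and on $\mathcal{A}_k$ the relation $\leq_{CA}$ coincides with $\leq_{AA}$.
   Context: $X^\omega$ carries the Cantor topology; $\bar k=\{0,\dots,k-1\}$; a $k$-partition of $X^\omega$ is a function $X^\omega\to\bar k$. An automaton is $\mathcal{M}=(Q,f,in)$ with finite $Q$, $f:Q\times X\to Q$, initial state $in$; $f_{\mathcal M}(\xi)$ is the set of states visited infinitely often on input $\xi\in X^\omega$. Regular $\omega$-languages are those of the form $\{\xi:f_{\mathcal M}(\xi)\in\mathcal F\}$ for some automaton $\mathcal M$ and set $\mathcal F$ of state sets. $\mathcal M$ is aperiodic if $f(q,u^n)=q$ with $u$ nonempty and $n>0$ implies $f(q,u)=q$; aperiodic $\omega$-languages are those recognised this way with $\mathcal M$ aperiodic. $\mathcal R_k$ ($\mathcal A_k$) is the set of $k$-partitions all of whose components are regular (aperiodic). An asynchronous transducer is an automaton $\mathcal M$ together with an output function $g:Q\times X\to X^*$; on input $\xi$ it outputs the concatenation of $g(f(in,\xi\upharpoonright_n),\xi(n))$, $n<\omega$. A DA-function is a function $X^\omega\to X^\omega$ computed by an asynchronous transducer; an AA-function is one computed by an asynchronous transducer whose automaton is aperiodic. For $k$-partitions $A,B$: $A\le_{CA}B$ iff $A=B\circ h$ for some continuous $h:X^\omega\to X^\omega$; $A\le_{DA}B$ (resp. $A\le_{AA}B$) iff $A=B\circ h$ for some DA-function (resp. AA-function) $h$.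 -}

module Defs where

open import Level using (0ℓ) renaming (suc to lsuc)
open import Data.Nat using (ℕ; _≤_; _<_)
open import Data.Fin using (Fin)
open import Data.Fin.Subset using (Subset) renaming (_∈_ to _∈ₛ_)
open import Data.List using (List; []; length; foldl; concat; replicate; applyUpTo)
open import Data.Product using (Σ; ∃; _×_)
open import Function using (_∘_; _⇔_)
open import Relation.Binary.PropositionalEquality using (_≡_; _≢_; _≗_)
open import Relation.Unary using (Pred; _∈_)

-- Alphabets are Fin m and state sets are Fin n.

Word : ℕ → Set
Word m = List (Fin m)

ωWord : ℕ → Set
ωWord m = ℕ → Fin m

_↾_ : ∀ {m} → ωWord m → ℕ → Word m
ξ ↾ n = applyUpTo ξ n

-- Openness in the Cantor topology: the sets { η | η ↾ n ≡ ξ ↾ n } form a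
-- base of neighbourhoods of ξ.  Function extensionality is not assumed, but an
-- open set is automatically closed under pointwise equality.

Open : ∀ {m} → Pred (ωWord m) 0ℓ → Set
Open U = ∀ ξ → ξ ∈ U → ∃ λ n → ∀ η → η ↾ n ≡ ξ ↾ n → η ∈ U

Continuous : ∀ {m} → (ωWord m → ωWord m) → Set₁
Continuous {m} h = (U : Pred (ωWord m) 0ℓ) → Open U → Open (U ∘ h)

record Automaton (m : ℕ) : Set where
  field
    size : ℕ

  Q : Set
  Q = Fin size

  field
    δ    : Q → Fin m → Q
    init : Q

  δ* : Q → Word m → Q
  δ* = foldl δ

  InfinitelyOften : ωWord m → Q → Set
  InfinitelyOften ξ q = ∀ n → ∃ λ l → n ≤ l × δ* init (ξ ↾ l) ≡ q

  IsLimitSet : ωWord m → Subset size → Set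
  IsLimitSet ξ S = ∀ q → q ∈ₛ S ⇔ InfinitelyOften ξ q

  Accepts : Pred (Subset size) 0ℓ → Pred (ωWord m) 0ℓ
  Accepts 𝓕 ξ = ∃ λ S → IsLimitSet ξ S × S ∈ 𝓕

  Aperiodic : Set
  Aperiodic = ∀ q u n → u ≢ [] → 0 < n →
              δ* q (concat (replicate n u)) ≡ q → δ* q u ≡ q

Recognizes : ∀ {m} (M : Automaton m) → Pred (ωWord m) 0ℓ → Set₁
Recognizes M L =
  Σ (Pred (Subset size) 0ℓ) λ 𝓕 → ∀ ξ → ξ ∈ L ⇔ ξ ∈ Accepts 𝓕
  where open Automaton M

RegularLanguage : ∀ {m} → Pred (ωWord m) 0ℓ → Set₁
RegularLanguage {m} L = Σ (Automaton m) λ M → Recognizes M L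

AperiodicLanguage : ∀ {m} → Pred (ωWord m) 0ℓ → Set₁
AperiodicLanguage {m} L =
  Σ (Automaton m) λ M → Automaton.Aperiodic M × Recognizes M L

-- A discontinuous partition, such as the one that tests whether a letter occurs
-- infinitely often, is definable as such a function only with excluded middle.
Partition : ℕ → ℕ → Set
Partition m k = ωWord m → Fin k

component : ∀ {m k} → Partition m k → Fin k → Pred (ωWord m) 0ℓ
component A i ξ = A ξ ≡ i

𝓡 : ∀ {m k} → Pred (Partition m k) (lsuc 0ℓ)
𝓡 A = ∀ i → RegularLanguage (component A i)

𝓐 : ∀ {m k} → Pred (Partition m k) (lsuc 0ℓ)
𝓐 A = ∀ i → AperiodicLanguage (component A i)

record Transducer (m : ℕ) : Set where
  field
    automaton : Automaton m

  open Automaton automaton public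

  field
    g : Q → Fin m → Word m

  -- The output produced while reading the first n letters of ξ.
  output : ωWord m → ℕ → Word m
  output ξ n = concat (applyUpTo (λ j → g (δ* init (ξ ↾ j)) (ξ j)) n)

  -- The concatenation of all outputs on ξ is the infinite word h ξ; the second
  -- component excludes transducers whose output on some ξ is finite.
  Computes : (ωWord m → ωWord m) → Set
  Computes h = ∀ ξ →
    (∀ n → output ξ n ≡ h ξ ↾ length (output ξ n)) ×
    (∀ l → ∃ λ n → l ≤ length (output ξ n))

DA-function : ∀ {m} → (ωWord m → ωWord m) → Set
DA-function {m} h = Σ (Transducer m) λ T → Transducer.Computes T h

AA-function : ∀ {m} → (ωWord m → ωWord m) → Set
AA-function {m} h =
  Σ (Transducer m) λ T → Transducer.Aperiodic T × Transducer.Computes T h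

infix 4 _≤CA_ _≤DA_ _≤AA_

_≤CA_ : ∀ {m k} → Partition m k → Partition m k → Set₁
A ≤CA B = ∃ λ h → Continuous h × A ≗ B ∘ h

_≤DA_ : ∀ {m k} → Partition m k → Partition m k → Set
A ≤DA B = ∃ λ h → DA-function h × A ≗ B ∘ h

_≤AA_ : ∀ {m k} → Partition m k → Partition m k → Set
A ≤AA B = ∃ λ h → AA-function h × A ≗ B ∘ h

{-# OPTIONS --safe #-}
module Submission where

-- Let M and N be automata whose limit sets determine A and B, and let h be a continuous
-- function with A = B ∘ h.  For a strongly connected set S of states of M, let T be a
-- minimal set of states of N such that, from some point on, h keeps N inside T as long as
-- the input keeps M inside S.  By minimality the input can keep forcing N through all of T
-- while M runs through all of S, so that A on the limit set S equals B on the limit set T.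
-- A transducer therefore only has to make N visit exactly such a T when M visits exactly S.
-- It remembers the states of M in the order of their latest appearance.  The tails of this
-- list are the candidate complements of S and determine a descending chain of minimal sets T;
-- when M revisits q′, the transducer tours the T that belongs to the tail behind q′.
-- If S is the set of states visited infinitely often, then eventually these tours stay in
-- the T chosen for S, and infinitely many of them exhaust it.  Reading a word twice changes
-- the order of latest appearance in the same way as reading it once, and the state of N is
-- a function of the memory; hence the transducer is aperiodic if M is.

open import Level using (0ℓ)
open import Axiom.ExcludedMiddle using (ExcludedMiddle)
open import Data.Bool using (Bool; true; false)
open import Data.Nat using (ℕ; zero; suc; _+_; _∸_; _*_; _⊔_; _≤_; _<_; z≤n; s≤s; s<s; z<s)
open import Data.Nat.Properties hiding (_≟_)
open import Data.Nat.DivMod using (_mod_; _%_; m%n<n; [m+kn]%n≡m%n; m<n⇒m%n≡m)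
open import Data.Fin using (Fin; zero; suc; toℕ; combine; remQuot; fromℕ<)
open import Data.Fin.Properties using (_≟_; toℕ<n; toℕ-injective; toℕ-fromℕ<; injective⇒≤; remQuot-combine; combine-remQuot)
open import Data.Fin.Subset using (Subset; _⊆_; _⊂_; Nonempty; ⊥) renaming (_∈_ to _∈ₛ_)
open import Data.Fin.Subset.Properties using (⊆-refl; nonempty?) renaming (_∈?_ to _∈ₛ?_)
open import Data.Fin.Subset.Induction using (⊂-wellFounded; Acc; acc)
import Data.Vec as Vec
open import Data.Vec.Properties using (lookup∘tabulate; []=⇒lookup; lookup⇒[]=)
open import Data.List using (List; []; _∷_; [_]; _++_; _∷ʳ_; length; lookup; foldl; concat; replicate; applyUpTo; filter; allFin; map; cartesianProduct; cartesianProductWith; initLast; _∷ʳ′_)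
open import Data.List.Properties using (++-assoc; ++-identityʳ; length-++; length-applyUpTo; applyUpTo-∷ʳ; foldl-++; foldl-∷ʳ; concat-++; filter-++; filter-all; filter-none; ∷-injectiveˡ; ∷-injectiveʳ)
open import Data.List.Membership.Propositional using (_∉_) renaming (_∈_ to _∈ₗ_)
open import Data.List.Membership.Propositional.Properties
open import Data.List.Relation.Unary.Any using (here; there; index)
open import Data.List.Relation.Unary.Any.Properties using (lookup-index)
open import Data.List.Relation.Unary.All as All using ([]; _∷_)
open import Data.List.Relation.Unary.AllPairs using ([]; _∷_)
open import Data.List.Relation.Unary.Unique.Propositional using (Unique)
import Data.List.Relation.Unary.Unique.Propositional.Properties as Unique
open import Data.Product using (Σ; ∃; _×_; _,_; proj₁; proj₂)
open import Data.Sum using (_⊎_; inj₁; inj₂)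
open import Function using (_∘_; _⇔_; mk⇔; Equivalence)
open import Relation.Nullary using (¬_; Dec; yes; no; does)
open import Relation.Nullary.Decidable using (¬?)
open import Relation.Nullary.Negation using (contradiction)
open import Relation.Binary.PropositionalEquality
  using (_≡_; _≢_; _≗_; refl; sym; trans; cong; cong₂; subst; module ≡-Reasoning)
open import Relation.Unary using (_∈_)
open import Defs

open Equivalence using (to; from)

-- ω-words, agreement up to a length, and splicing

Agree : ∀ {m} → ℕ → ωWord m → ωWord m → Set
Agree n ξ η = ∀ {j} → j < n → ξ j ≡ η j

agree-sym : ∀ {m n} {ξ η : ωWord m} → Agree n ξ η → Agree n η ξ
agree-sym a j<n = sym (a j<n)

agree-trans : ∀ {m n} {ξ η ζ : ωWord m} → Agree n ξ η → Agree n η ζ → Agree n ξ ζ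
agree-trans a b j<n = trans (a j<n) (b j<n)

agree-≤ : ∀ {m n k} {ξ η : ωWord m} → k ≤ n → Agree n ξ η → Agree k ξ η
agree-≤ k≤n a j<k = a (<-≤-trans j<k k≤n)

↾⇒agree : ∀ {m} n {ξ η : ωWord m} → ξ ↾ n ≡ η ↾ n → Agree n ξ η
↾⇒agree (suc n) eq {zero}  _       = ∷-injectiveˡ eq
↾⇒agree (suc n) eq {suc j} (s≤s l) = ↾⇒agree n (∷-injectiveʳ eq) l

agree⇒↾ : ∀ {m} n {ξ η : ωWord m} → Agree n ξ η → ξ ↾ n ≡ η ↾ n
agree⇒↾ zero    a = refl
agree⇒↾ (suc n) a = cong₂ _∷_ (a z<s) (agree⇒↾ n (λ l → a (s<s l)))

shift : ∀ {m} → ℕ → ωWord m → ωWord m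
shift a ξ j = ξ (a + j)

splice : ∀ {m} → ωWord m → ℕ → ωWord m → ωWord m
splice ξ zero    ζ         = ζ
splice ξ (suc n) ζ zero    = ξ zero
splice ξ (suc n) ζ (suc j) = splice (ξ ∘ suc) n ζ j

splice-agree : ∀ {m} (ξ : ωWord m) n ζ → Agree n ξ (splice ξ n ζ)
splice-agree ξ (suc n) ζ {zero}  _       = refl
splice-agree ξ (suc n) ζ {suc j} (s≤s l) = splice-agree (ξ ∘ suc) n ζ l

splice-shift : ∀ {m} (ξ : ωWord m) n ζ j → shift n (splice ξ n ζ) j ≡ ζ j
splice-shift ξ zero    ζ j = refl
splice-shift ξ (suc n) ζ j = splice-shift (ξ ∘ suc) n ζ j

module _ {m} (ξs : ℕ → ωWord m) (ns : ℕ → ℕ)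
         (increasing : ∀ i → ns i < ns (suc i))
         (agreeing : ∀ i → Agree (ns i) (ξs i) (ξs (suc i))) where

  -- The letter `j` can be read off `ξs (suc j)`: since `j < ns (suc j)` by `i≤ns`, no later word
  -- changes it.
  limit : ωWord m
  limit j = ξs (suc j) j

  i≤ns : ∀ i → i ≤ ns i
  i≤ns zero    = z≤n
  i≤ns (suc i) = ≤-trans (s≤s (i≤ns i)) (increasing i)

  private
    ns-mono : ∀ i k → ns i ≤ ns (k + i)
    ns-mono i zero    = ≤-refl
    ns-mono i (suc k) = ≤-trans (ns-mono i k) (<⇒≤ (increasing (k + i)))

    agree-later : ∀ i k → Agree (ns i) (ξs i) (ξs (k + i))
    agree-later i zero    l = refl
    agree-later i (suc k) l =
      trans (agree-later i k l) (agreeing (k + i) (<-≤-trans l (ns-mono i k)))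

    agree-≤-later : ∀ {i i′} → i ≤ i′ → Agree (ns i) (ξs i) (ξs i′)
    agree-≤-later {i} {i′} i≤i′ l =
      trans (agree-later i (i′ ∸ i) l) (cong (λ k → ξs k _) (m∸n+n≡m i≤i′))

  limit-agree : ∀ i → Agree (ns i) (ξs i) limit
  limit-agree i {j} l with ≤-total i (suc j)
  ... | inj₁ i≤j = agree-≤-later i≤j l
  ... | inj₂ j≤i = sym (agree-≤-later j≤i (i≤ns (suc j)))

-- Runs of automata

module Run {m} (M : Automaton m) where
  open Automaton M

  run : Q → ωWord m → ℕ → Q
  run q ξ zero    = q
  run q ξ (suc n) = δ (run q ξ n) (ξ n)

  run-agree : ∀ {ξ η n} → Agree n ξ η → ∀ q {j} → j ≤ n → run q ξ j ≡ run q η j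
  run-agree a q {zero}  _ = refl
  run-agree a q {suc j} l = cong₂ δ (run-agree a q (<⇒≤ l)) (a l)

  run-shift : ∀ q ξ a b → run q ξ (a + b) ≡ run (run q ξ a) (shift a ξ) b
  run-shift q ξ a zero    = cong (run q ξ) (+-identityʳ a)
  run-shift q ξ a (suc b) rewrite +-suc a b = cong (λ r → δ r (ξ (a + b))) (run-shift q ξ a b)

  run-splice : ∀ q ξ n ζ j → run q (splice ξ n ζ) (n + j) ≡ run (run q ξ n) ζ j
  run-splice q ξ n ζ j = trans (run-shift q (splice ξ n ζ) n j)
    (trans (cong (λ r → run r (shift n (splice ξ n ζ)) j)
             (sym (run-agree (splice-agree ξ n ζ) q ≤-refl)))
           (run-agree {n = j} (λ {i} _ → splice-shift ξ n ζ i) _ ≤-refl))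

  run-splice-≤ : ∀ q ξ n ζ {j} → j ≤ n → run q (splice ξ n ζ) j ≡ run q ξ j
  run-splice-≤ q ξ n ζ j≤n = sym (run-agree (splice-agree ξ n ζ) q j≤n)

  δ*-↾ : ∀ q ξ n → δ* q (ξ ↾ n) ≡ run q ξ n
  δ*-↾ q ξ zero    = refl
  δ*-↾ q ξ (suc n) = begin
    δ* q (applyUpTo ξ (suc n))    ≡⟨ cong (δ* q) (applyUpTo-∷ʳ ξ n) ⟨
    δ* q (applyUpTo ξ n ∷ʳ ξ n)   ≡⟨ foldl-∷ʳ δ q (ξ n) (applyUpTo ξ n) ⟩
    δ (δ* q (ξ ↾ n)) (ξ n)        ≡⟨ cong (λ r → δ r (ξ n)) (δ*-↾ q ξ n) ⟩
    δ (run q ξ n) (ξ n)           ∎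
    where open ≡-Reasoning

  Reach : Q → Q → Set
  Reach q r = ∃ λ ζ → ∃ λ l → run q ζ l ≡ r

  reach-trans : ∀ {q r s} → Reach q r → Reach r s → Reach q s
  reach-trans {q} (ζ , l , refl) (ζ′ , l′ , eq) =
    splice ζ l ζ′ , l + l′ , trans (run-splice q ζ l ζ′ l′) eq

  reach-run : ∀ q ξ {a b} → a ≤ b → Reach (run q ξ a) (run q ξ b)
  reach-run q ξ {a} {b} a≤b = shift a ξ , b ∸ a ,
    trans (sym (run-shift q ξ a (b ∸ a))) (cong (run q ξ) (m+[n∸m]≡n a≤b))

  reach-refl : ωWord m → ∀ {q} → Reach q q
  reach-refl ζ = ζ , 0 , refl

  reach-δ : ∀ q x → Reach q (δ q x)
  reach-δ q x = (λ _ → x) , 1 , refl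

  -- Paths have at least one letter, so a one-element set is connected only if its state has a loop.
  -- This is what allows an input to remain in `S` forever.
  Connected : (Q → Set) → Set
  Connected S = ∀ {s s′} → S s → S s′ → ∃ λ ζ → ∃ λ l →
    run s ζ (suc l) ≡ s′ × (∀ {j} → j ≤ suc l → S (run s ζ j))

  connected-resp : ∀ {S S′ : Q → Set} → (∀ q → S q ⇔ S′ q) → Connected S → Connected S′
  connected-resp e c s s′ with c (from (e _) s) (from (e _) s′)
  ... | ζ , l , eq , inside = ζ , l , eq , λ j≤ → to (e _) (inside j≤)

  connected⇒reach : ∀ {S : Q → Set} → Connected S → ∀ {s s′} → S s → S s′ → Reach s s′
  connected⇒reach c s s′ with c s s′
  ... | ζ , l , eq , _ = ζ , suc l , eq

  module _ {S : Q → Set} (c : Connected S) where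
    private
      state : Σ Q S → ℕ → Σ Q S
      letter : Σ Q S → Fin m
      letter (s , p) = proj₁ (c p p) 0
      state s zero    = s
      state s (suc n) with state s n
      ... | r , p = δ r (letter (r , p)) , proj₂ (proj₂ (proj₂ (c p p))) (s≤s z≤n)

      run-state : ∀ s n → run (proj₁ s) (letter ∘ state s) n ≡ proj₁ (state s n)
      run-state s zero    = refl
      run-state s (suc n) = cong (λ r → δ r (letter (state s n))) (run-state s n)

    -- Every state of `S` lies on a nonempty loop inside `S`. Playing only the first letter of such
    -- a loop and then choosing a new one never leaves `S`.
    connected⇒stay : ∀ {s} → S s → ∃ λ ζ → ∀ j → S (run s ζ j)
    connected⇒stay {s} p = letter ∘ state (s , p) ,
      λ j → subst S (sym (run-state (s , p) j)) (proj₂ (state (s , p) j))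

  -- The starting state does not count as visited, so a tour of a nonempty `T` has positive length.
  -- This keeps the output of the transducer infinite.
  Covers : Subset size → Q → ωWord m → ℕ → Set
  Covers T q ζ l = (∀ {j} → j ≤ l → run q ζ j ∈ₛ T)
    × (∀ {r} → r ∈ₛ T → ∃ λ j → suc j ≤ l × run q ζ (suc j) ≡ r)

  module _ {T : Subset size} (c : Connected (_∈ₛ T)) where
    private
      visitAll : ∀ (rs : List Q) {q q′} → q ∈ₛ T → q′ ∈ₛ T → ∃ λ ζ → ∃ λ l →
        run q ζ l ≡ q′ × (∀ {j} → j ≤ l → run q ζ j ∈ₛ T)
        × (∀ {r} → r ∈ₗ rs → r ∈ₛ T → ∃ λ j → suc j ≤ l × run q ζ (suc j) ≡ r)
      visitAll [] q∈ q′∈ with c q∈ q′∈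
      ... | ζ , l , eq , inside = ζ , suc l , eq , inside , λ ()
      visitAll (r ∷ rs) {q} q∈ q′∈ with r ∈ₛ? T
      ... | no r∉ with visitAll rs q∈ q′∈
      ...   | ζ , l , eq , inside , all = ζ , l , eq , inside ,
              λ { (here refl) r∈ → contradiction r∈ r∉ ; (there i) r∈ → all i r∈ }
      visitAll (r ∷ rs) {q} q∈ q′∈ | yes r∈T with c q∈ r∈T
      ... | ζ , l , refl , inside with visitAll rs r∈T q′∈
      ...   | ζ′ , l′ , eq′ , inside′ , all =
        splice ζ (suc l) ζ′ , suc l + l′ , trans (second l′) eq′ , inside″ , all″
        where
        second : ∀ j → run q (splice ζ (suc l) ζ′) (suc l + j) ≡ run (run q ζ (suc l)) ζ′ j
        second = run-splice q ζ (suc l) ζ′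
        first : ∀ {j} → j ≤ suc l → run q (splice ζ (suc l) ζ′) j ≡ run q ζ j
        first = run-splice-≤ q ζ (suc l) ζ′
        inside″ : ∀ {j} → j ≤ suc l + l′ → run q (splice ζ (suc l) ζ′) j ∈ₛ T
        inside″ {j} j≤ with ≤-total j (suc l)
        ... | inj₁ j≤l = subst (_∈ₛ T) (sym (first j≤l)) (inside j≤l)
        ... | inj₂ l≤j = subst (λ i → run q (splice ζ (suc l) ζ′) i ∈ₛ T) (m+[n∸m]≡n l≤j)
          (subst (_∈ₛ T) (sym (second (j ∸ suc l))) (inside′ (m≤n+o⇒m∸n≤o _ (suc l) j≤)))
        all″ : ∀ {r′} → r′ ∈ₗ (run q ζ (suc l) ∷ rs) → r′ ∈ₛ T →
          ∃ λ j → suc j ≤ suc l + l′ × run q (splice ζ (suc l) ζ′) (suc j) ≡ r′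
        all″ (here refl) _ = l , m≤m+n (suc l) l′ , first ≤-refl
        all″ (there i) r∈ with all i r∈
        ... | j , j<l′ , eq = l + suc j , s≤s (+-monoʳ-≤ l j<l′) , trans (second (suc j)) eq

    cover : ∀ {q q′} → q ∈ₛ T → q′ ∈ₛ T → ∃ λ ζ → ∃ λ l → run q ζ l ≡ q′ × Covers T q ζ l
    cover q∈ q′∈ with visitAll (allFin size) q∈ q′∈
    ... | ζ , l , eq , inside , all = ζ , l , eq , inside , all (∈-allFin _)

-- Infinitely recurring values, classically

Recurs : ∀ {A : Set} → (ℕ → A) → A → Set
Recurs f a = ∀ n → ∃ λ l → n ≤ l × f l ≡ a

module _ {m} (M : Automaton m) where
  open Automaton M
  open Run M

  recurs-run : ∀ ξ q → InfinitelyOften ξ q ⇔ Recurs (run init ξ) q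
  recurs-run ξ q = mk⇔ (λ io n → recurs (io n)) (λ r n → often (r n))
    where
    recurs : ∀ {n} → (∃ λ l → n ≤ l × δ* init (ξ ↾ l) ≡ q) → ∃ λ l → n ≤ l × run init ξ l ≡ q
    recurs (l , n≤l , eq) = l , n≤l , trans (sym (δ*-↾ init ξ l)) eq
    often : ∀ {n} → (∃ λ l → n ≤ l × run init ξ l ≡ q) → ∃ λ l → n ≤ l × δ* init (ξ ↾ l) ≡ q
    often (l , n≤l , eq) = l , n≤l , trans (δ*-↾ init ξ l) eq

  -- The run itself supplies the paths, since past `N` it meets only recurring states. The target is
  -- sought from `suc a` on, which makes the path nonempty.
  recurrent-connected : ∀ ξ N → (∀ {n} → N ≤ n → Recurs (run init ξ) (run init ξ n)) →
                        Connected (Recurs (run init ξ))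
  recurrent-connected ξ N eventually {s} {s′} io io′ with io N
  ... | a , N≤a , refl with io′ (suc a)
  ...   | b , a<b , refl = shift a ξ , b ∸ suc a ,
    trans (sym (run-shift init ξ a _)) (cong (run init ξ) a+[b∸a]≡b) ,
    λ {j} _ → subst (Recurs (run init ξ)) (run-shift init ξ a j)
                (eventually (≤-trans N≤a (m≤m+n a j)))
    where
    a+[b∸a]≡b : a + suc (b ∸ suc a) ≡ b
    a+[b∸a]≡b = trans (+-suc a _) (m+[n∸m]≡n a<b)

SameLimit : ∀ {m} → Automaton m → ωWord m → ωWord m → Set
SameLimit M ξ η = ∀ q → Recurs (run init ξ) q ⇔ Recurs (run init η) q
  where
  open Automaton M
  open Run M

uniformBound : ∀ {n} (P : Fin n → ℕ → Set) → (∀ {i j k} → j ≤ k → P i j → P i k) →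
               (∀ i → ∃ (P i)) → ∃ λ k → ∀ i → P i k
uniformBound {zero}  P mono bound = 0 , λ ()
uniformBound {suc n} P mono bound with bound zero | uniformBound (P ∘ suc) mono (bound ∘ suc)
... | j , p | k , ps = j ⊔ k ,
  λ { zero → mono (m≤m⊔n j k) p ; (suc i) → mono (m≤n⊔m j k) (ps i) }

enumerate : ∀ {n} → Fin n → ℕ → Fin n
enumerate {suc n} _ i = i mod suc n

enumerate-recurs : ∀ {n} (q r : Fin n) → Recurs (enumerate q) r
enumerate-recurs {suc n} q r k = toℕ r + k * suc n ,
  ≤-trans (m≤m*n k (suc n)) (m≤n+m _ (toℕ r)) ,
  toℕ-injective (begin
    toℕ ((toℕ r + k * suc n) mod suc n)  ≡⟨ toℕ-fromℕ< (m%n<n (toℕ r + k * suc n) (suc n)) ⟩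
    (toℕ r + k * suc n) % suc n          ≡⟨ [m+kn]%n≡m%n (toℕ r) k (suc n) ⟩
    toℕ r % suc n                        ≡⟨ m<n⇒m%n≡m (toℕ<n r) ⟩
    toℕ r                                ∎)
  where open ≡-Reasoning

module Classical (em : ExcludedMiddle 0ℓ) where

  abstract
    -- A value that does not recur is absent from some point on, and the bounds for finitely many
    -- values have a maximum.
    eventuallyRecurrent : ∀ {n} (f : ℕ → Fin n) → ∃ λ N → ∀ {j} → N ≤ j → Recurs f (f j)
    eventuallyRecurrent {n} f with uniformBound P (λ j≤k p k≤l → p (≤-trans j≤k k≤l)) bound
      where
      P : Fin n → ℕ → Set
      P q k = ∀ {l} → k ≤ l → f l ≡ q → Recurs f q
      bound : ∀ q → ∃ (P q)
      bound q with em {Recurs f q}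
      ... | yes r = 0 , λ _ _ → r
      ... | no ¬r with em {∃ λ k → ∀ {l} → k ≤ l → f l ≢ q}
      ...   | yes (k , never) = k , λ k≤l eq → contradiction eq (never k≤l)
      ...   | no ¬k = contradiction recurs ¬r
        where
        recurs : Recurs f q
        recurs k with em {∃ λ l → k ≤ l × f l ≡ q}
        ... | yes visit = visit
        ... | no ¬visit = contradiction (k , λ {l} k≤l eq → ¬visit (l , k≤l , eq)) ¬k
    ... | N , recurs = N , λ {j} N≤j → recurs (f j) N≤j refl

  abstract
    ⟦_⟧ : ∀ {n} → (Fin n → Set) → Subset n
    ⟦ P ⟧ = Vec.tabulate (λ i → does (em {P i}))

    ∈⟦⟧ : ∀ {n} (P : Fin n → Set) i → i ∈ₛ ⟦ P ⟧ ⇔ P i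
    ∈⟦⟧ P i = mk⇔
      (λ i∈ → does⇒ (trans (sym (lookup∘tabulate _ i)) ([]=⇒lookup i∈)))
      (λ p → lookup⇒[]= i ⟦ P ⟧ (trans (lookup∘tabulate _ i) (⇒does p)))
      where
      does⇒ : does (em {P i}) ≡ true → P i
      does⇒ eq with yes p ← em {P i} = p
      ⇒does : P i → does (em {P i}) ≡ true
      ⇒does p with em {P i}
      ... | yes _ = refl
      ... | no ¬p = contradiction p ¬p

    minimalSubset : ∀ {n} (W : Subset n → Set) {T} → W T →
      ∃ λ T′ → T′ ⊆ T × W T′ × (∀ {U} → U ⊆ T′ → W U → T′ ⊆ U)
    minimalSubset {n} W w = go (⊂-wellFounded _) w
      where
      go : ∀ {T} → Acc _⊂_ T → W T →
        ∃ λ T′ → T′ ⊆ T × W T′ × (∀ {U} → U ⊆ T′ → W U → T′ ⊆ U)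
      go {T} (acc rec) w with em {∃ λ U → U ⊆ T × W U × ∃ λ i → i ∈ₛ T × ¬ i ∈ₛ U}
      ... | yes (U , U⊆T , wU , smaller) with go (rec ((λ {_} → U⊆T) , smaller)) wU
      ...   | T′ , T′⊆U , rest = T′ , (λ {_} i∈ → U⊆T (T′⊆U i∈)) , rest
      go {T} (acc rec) w | no ¬smaller = T , ⊆-refl , w , λ {_} → minimal
        where
        minimal : ∀ {U} → U ⊆ T → W U → T ⊆ U
        minimal {U} U⊆T wU {i} i∈T with i ∈ₛ? U
        ... | yes i∈U = i∈U
        ... | no i∉U = contradiction (U , (λ {_} → U⊆T) , wU , i , i∈T , i∉U) ¬smaller

filter-filter : ∀ {A : Set} {P Q R : A → Set} (P? : ∀ x → Dec (P x)) (Q? : ∀ x → Dec (Q x))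
  (R? : ∀ x → Dec (R x)) → (∀ x → P x ⇔ (Q x × R x)) →
  ∀ l → filter Q? (filter R? l) ≡ filter P? l
filter-filter P? Q? R? e []      = refl
filter-filter P? Q? R? e (x ∷ l) with R? x
filter-filter P? Q? R? e (x ∷ l) | no ¬r with P? x
... | yes p = contradiction (proj₂ (to (e x) p)) ¬r
... | no _  = filter-filter P? Q? R? e l
filter-filter P? Q? R? e (x ∷ l) | yes r with Q? x | P? x
... | yes _ | yes _ = cong (x ∷_) (filter-filter P? Q? R? e l)
... | yes q | no ¬p = contradiction (from (e x) (q , r)) ¬p
... | no ¬q | yes p = contradiction (proj₁ (to (e x) p)) ¬q
... | no _  | no _  = filter-filter P? Q? R? e l

-- Lists of states in the order of their latest appearance

module Recency {n : ℕ} where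
  open import Data.List.Membership.DecPropositional (_≟_ {n}) using (_∈?_; _∉?_)

  without : Fin n → List (Fin n) → List (Fin n)
  without q = filter (λ r → ¬? (r ≟ q))

  moveToFront : List (Fin n) → Fin n → List (Fin n)
  moveToFront l q = q ∷ without q l

  visit : List (Fin n) → List (Fin n) → List (Fin n)
  visit = foldl moveToFront

  -- The entries behind the last occurrence of q; all but the first if q does not occur.
  after : Fin n → List (Fin n) → List (Fin n)
  after q []      = []
  after q (r ∷ l) with q ∈? l
  ... | yes _ = after q l
  ... | no  _ = l

  ∈-without : ∀ {q r l} → r ≢ q → r ∈ₗ l → r ∈ₗ without q l
  ∈-without r≢q r∈ = ∈-filter⁺ (λ r → ¬? (r ≟ _)) r∈ r≢q

  ∈-without⁻ : ∀ {q r} l → r ∈ₗ without q l → r ∈ₗ l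
  ∈-without⁻ {q} l r∈ = proj₁ (∈-filter⁻ (λ r → ¬? (r ≟ q)) {xs = l} r∈)

  moveToFront-∈ : ∀ {q r l} → r ∈ₗ l → r ∈ₗ moveToFront l q
  moveToFront-∈ {q} {r} r∈ with r ≟ q
  ... | yes refl = here refl
  ... | no r≢q   = there (∈-without r≢q r∈)

  moveToFront-unique : ∀ {q l} → Unique l → Unique (moveToFront l q)
  moveToFront-unique {q} {l} u =
    All.tabulate (λ r∈ eq → proj₂ (∈-filter⁻ (λ r → ¬? (r ≟ q)) {xs = l} r∈) (sym eq))
    ∷ Unique.filter⁺ (λ r → ¬? (r ≟ q)) u

  ∈-visit : ∀ rs {l r} → r ∈ₗ visit l rs → r ∈ₗ rs ⊎ r ∈ₗ l
  ∈-visit []       r∈ = inj₂ r∈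
  ∈-visit (q ∷ rs) {l} r∈ with ∈-visit rs r∈
  ... | inj₁ r∈rs          = inj₁ (there r∈rs)
  ... | inj₂ (here refl)   = inj₁ (here refl)
  ... | inj₂ (there r∈l)   = inj₂ (∈-without⁻ l r∈l)

  filter-∉-∷ : ∀ q rs l → filter (_∉? rs) (without q l) ≡ filter (_∉? (q ∷ rs)) l
  filter-∉-∷ q rs = filter-filter (_∉? (q ∷ rs)) (_∉? rs) (λ r → ¬? (r ≟ q))
    (λ r → mk⇔ (λ r∉ → (λ r∈ → r∉ (there r∈)) , (λ eq → r∉ (here eq)))
               (λ { (r∉ , r≢q) (here eq) → r≢q eq ; (r∉ , r≢q) (there r∈) → r∉ r∈ }))

  -- The front depends only on the states read, and the states not read keep their order at the
  -- back. Both the idempotence of `visit` and the stable tail of the recency list come from this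
  -- split.
  visit-decompose : ∀ rs l → visit l rs ≡ visit [] rs ++ filter (_∉? rs) l
  visit-decompose []       l = sym (filter-all (_∉? []) (All.tabulate (λ _ ())))
  visit-decompose (q ∷ rs) l = begin
    visit (q ∷ without q l) rs
      ≡⟨ visit-decompose rs (q ∷ without q l) ⟩
    visit [] rs ++ filter (_∉? rs) ([ q ] ++ without q l)
      ≡⟨ cong (visit [] rs ++_) (filter-++ (_∉? rs) [ q ] (without q l)) ⟩
    visit [] rs ++ (filter (_∉? rs) [ q ] ++ filter (_∉? rs) (without q l))
      ≡⟨ ++-assoc (visit [] rs) _ _ ⟨
    (visit [] rs ++ filter (_∉? rs) [ q ]) ++ filter (_∉? rs) (without q l)
      ≡⟨ cong₂ _++_ (sym (visit-decompose rs [ q ])) (filter-∉-∷ q rs l) ⟩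
    visit [ q ] rs ++ filter (_∉? (q ∷ rs)) l ∎
    where open ≡-Reasoning

  -- On the second pass the old front consists of entries of `rs` and is filtered out, while the
  -- back contains none of them and survives whole.
  visit-idempotent : ∀ rs l → visit (visit l rs) rs ≡ visit l rs
  visit-idempotent rs l = begin
    visit (visit l rs) rs
      ≡⟨ visit-decompose rs (visit l rs) ⟩
    visit [] rs ++ filter (_∉? rs) (visit l rs)
      ≡⟨ cong (λ l′ → visit [] rs ++ filter (_∉? rs) l′) (visit-decompose rs l) ⟩
    visit [] rs ++ filter (_∉? rs) (visit [] rs ++ filter (_∉? rs) l)
      ≡⟨ cong (visit [] rs ++_) (filter-++ (_∉? rs) (visit [] rs) _) ⟩
    visit [] rs ++ (filter (_∉? rs) (visit [] rs) ++ filter (_∉? rs) (filter (_∉? rs) l))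
      ≡⟨ cong (visit [] rs ++_) (cong₂ _++_ (filter-none (_∉? rs) (All.tabulate visited))
                                            (filter-all (_∉? rs) (All.tabulate unvisited))) ⟩
    visit [] rs ++ filter (_∉? rs) l
      ≡⟨ visit-decompose rs l ⟨
    visit l rs ∎
    where
    open ≡-Reasoning
    visited : ∀ {r} → r ∈ₗ visit [] rs → ¬ r ∉ rs
    visited r∈ r∉ with ∈-visit rs {[]} r∈
    ... | inj₁ r∈rs = r∉ r∈rs
    unvisited : ∀ {r} → r ∈ₗ filter (_∉? rs) l → r ∉ rs
    unvisited r∈ = proj₂ (∈-filter⁻ (_∉? rs) {xs = l} r∈)

  visit-replicate : ∀ k rs l → visit l (concat (replicate (suc k) rs)) ≡ visit l rs
  visit-replicate zero    rs l = cong (visit l) (++-identityʳ rs)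
  visit-replicate (suc k) rs l = begin
    visit l (rs ++ concat (replicate (suc k) rs))  ≡⟨ foldl-++ moveToFront l rs _ ⟩
    visit (visit l rs) (concat (replicate (suc k) rs)) ≡⟨ visit-replicate k rs (visit l rs) ⟩
    visit (visit l rs) rs                          ≡⟨ visit-idempotent rs l ⟩
    visit l rs                                     ∎
    where open ≡-Reasoning

  moveToFront-++ : ∀ {q t} f → q ∉ t → moveToFront (f ++ t) q ≡ moveToFront f q ++ t
  moveToFront-++ {q} {t} f q∉t = cong (q ∷_) (trans (filter-++ (λ r → ¬? (r ≟ q)) f t)
    (cong (without q f ++_) (filter-all (λ r → ¬? (r ≟ q))
      (All.tabulate (λ r∈ eq → q∉t (subst (_∈ₗ t) eq r∈))))))

  after-++ : ∀ {q} f {t} → q ∈ₗ f → q ∉ t → after q (f ++ t) ≡ after q f ++ t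
  after-++ {q} (r ∷ f) {t} q∈ q∉t with q ∈? (f ++ t) | q ∈? f
  ... | yes _  | yes q∈f = after-++ f q∈f q∉t
  ... | no _   | no _    = refl
  ... | no q∉  | yes q∈f = contradiction (∈-++⁺ˡ q∈f) q∉
  ... | yes q∈ft | no q∉f with ∈-++⁻ f q∈ft
  ...   | inj₁ q∈f = contradiction q∈f q∉f
  ...   | inj₂ q∈t = contradiction q∈t q∉t

  after-∷ : ∀ {q t} ys → q ∉ t → after q (ys ++ q ∷ t) ≡ t
  after-∷ {q} {t} [] q∉t with q ∈? t
  ... | yes q∈t = contradiction q∈t q∉t
  ... | no _    = refl
  after-∷ {q} {t} (y ∷ ys) q∉t with q ∈? (ys ++ q ∷ t)
  ... | yes _ = after-∷ ys q∉t
  ... | no q∉ = contradiction (∈-++⁺ʳ ys (here refl)) q∉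

  lastOccurrence : ∀ {q} l → q ∈ₗ l → ∃ λ ys → ∃ λ t → l ≡ ys ++ q ∷ t × q ∉ t
  lastOccurrence {q} (r ∷ l) q∈ with q ∈? l
  ... | yes q∈l with lastOccurrence l q∈l
  ...   | ys , t , refl , q∉t = r ∷ ys , t , refl , q∉t
  lastOccurrence (q ∷ l) (here refl) | no q∉l = [] , l , refl , q∉l
  lastOccurrence (r ∷ l) (there q∈l) | no q∉l = contradiction q∈l q∉l

  after-suffix : ∀ {q} l → q ∈ₗ l → ∃ λ ys → l ≡ ys ++ after q l
  after-suffix {q} l q∈ with lastOccurrence l q∈
  ... | ys , t , refl , q∉t = ys ++ [ q ] ,
    trans (sym (++-assoc ys [ q ] t)) (cong ((ys ++ [ q ]) ++_) (sym (after-∷ ys q∉t)))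

  -- Removing `q` touches nothing behind its last occurrence. With `after-suffix`, the list ends in
  -- `after q l` both before and after the move, so both ends of a tour lie in the set that belongs
  -- to this tail.
  moveToFront-after : ∀ {q} l → q ∈ₗ l → ∃ λ ys → moveToFront l q ≡ ys ++ after q l
  moveToFront-after {q} l q∈ with lastOccurrence l q∈
  ... | ys , t , refl , q∉t = moveToFront (ys ++ [ q ]) q , (begin
    moveToFront (ys ++ q ∷ t) q
      ≡⟨ cong (λ l → moveToFront l q) (++-assoc ys [ q ] t) ⟨
    moveToFront ((ys ++ [ q ]) ++ t) q
      ≡⟨ moveToFront-++ (ys ++ [ q ]) q∉t ⟩
    moveToFront (ys ++ [ q ]) q ++ t
      ≡⟨ cong (moveToFront (ys ++ [ q ]) q ++_) (after-∷ ys q∉t) ⟨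
    moveToFront (ys ++ [ q ]) q ++ after q (ys ++ q ∷ t) ∎)
    where open ≡-Reasoning

-- Machines with structured states as finite automata

unique-lookup-injective : ∀ {A : Set} {l : List A} → Unique l →
                          ∀ {i j} → lookup l i ≡ lookup l j → i ≡ j
unique-lookup-injective (_ ∷ _) {zero}  {zero}  _  = refl
unique-lookup-injective {l = _ ∷ l} (x∉ ∷ _) {zero}  {suc j} eq =
  contradiction eq (All.lookup x∉ (∈-lookup j))
unique-lookup-injective {l = _ ∷ l} (x∉ ∷ _) {suc i} {zero}  eq =
  contradiction (sym eq) (All.lookup x∉ (∈-lookup i))
unique-lookup-injective (_ ∷ u) {suc i} {suc j} eq = cong suc (unique-lookup-injective u eq)

unique⇒length≤ : ∀ {n} {l : List (Fin n)} → Unique l → length l ≤ n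
unique⇒length≤ u = injective⇒≤ (unique-lookup-injective u)

listsUpTo : ∀ n → ℕ → List (List (Fin n))
listsUpTo n zero    = [ [] ]
listsUpTo n (suc k) = [] ∷ cartesianProductWith _∷_ (allFin n) (listsUpTo n k)

∈-listsUpTo : ∀ {n k} (l : List (Fin n)) → length l ≤ k → l ∈ₗ listsUpTo n k
∈-listsUpTo {k = zero}  []      _ = here refl
∈-listsUpTo {k = suc k} []      _ = here refl
∈-listsUpTo {k = suc k} (x ∷ l) (s≤s ≤k) =
  there (∈-cartesianProductWith⁺ _∷_ (∈-allFin x) (∈-listsUpTo l ≤k))

module Realize (em : ExcludedMiddle 0ℓ) {m : ℕ} {State : Set}
  (step : State → Fin m → State) (Inv : State → Set)
  (inv-step : ∀ {s} x → Inv s → Inv (step s x))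
  (start : State) (inv-start : Inv start)
  (states : List State) (complete : ∀ {s} → Inv s → s ∈ₗ states) where

  private
    -- Only states with the invariant are kept, so `decode-inv` holds also at unreachable states,
    -- and outputs can be chosen from a proof of the invariant everywhere.
    good : List State
    good = filter (λ s → em {Inv s}) states

    ∈-good : ∀ {s} → Inv s → s ∈ₗ good
    ∈-good i = ∈-filter⁺ (λ s → em {Inv s}) (complete i) i

  decode : Fin (length good) → State
  decode = lookup good

  decode-inv : ∀ i → Inv (decode i)
  decode-inv i = proj₂ (∈-filter⁻ (λ s → em {Inv s}) {xs = states} (∈-lookup i))

  private
    -- Membership is decided rather than passed as a proof, so the code depends on the state alone.
    -- The second case is a default that does not occur for states with the invariant.
    encode : State → Fin (length good)
    encode s with em {s ∈ₗ good}
    ... | yes s∈ = index s∈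
    ... | no _   = index (∈-good inv-start)

    decode-encode : ∀ {s} → Inv s → decode (encode s) ≡ s
    decode-encode {s} i with em {s ∈ₗ good}
    ... | yes s∈ = sym (lookup-index s∈)
    ... | no s∉  = contradiction (∈-good i) s∉

  automaton : Automaton m
  automaton = record
    { size = length good ; δ = λ i x → encode (step (decode i) x) ; init = encode start }

  open Automaton automaton

  decode-init : decode init ≡ start
  decode-init = decode-encode inv-start

  decode-δ : ∀ i x → decode (δ i x) ≡ step (decode i) x
  decode-δ i x = decode-encode (inv-step x (decode-inv i))

  private
    decode-δ* : ∀ i u → decode (δ* i u) ≡ foldl step (decode i) u
    decode-δ* i []      = refl
    decode-δ* i (x ∷ u) = trans (decode-δ* (δ i x) u)
      (cong (λ s → foldl step s u) (decode-δ i x))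

    δ*-encode : ∀ i u → u ≢ [] → δ* i u ≡ encode (foldl step (decode i) u)
    δ*-encode i []          u≢[] = contradiction refl u≢[]
    δ*-encode i (x ∷ [])    _    = refl
    δ*-encode i (x ∷ y ∷ u) _    = trans (δ*-encode (δ i x) (y ∷ u) (λ ()))
      (cong (λ s → encode (foldl step s (y ∷ u))) (decode-δ i x))

  -- decode need not be injective, as `states` may contain repetitions, but a state
  -- reached by a nonempty word is determined by its decoding.
  realize-aperiodic :
    (∀ s u n → u ≢ [] → 0 < n → foldl step s (concat (replicate n u)) ≡ s → foldl step s u ≡ s) →
    Aperiodic
  realize-aperiodic aperiodic i []        _       u≢[] _   _  = contradiction refl u≢[]
  realize-aperiodic aperiodic i u@(_ ∷ _) (suc n) u≢[] 0<n eq = begin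
    δ* i u                               ≡⟨ δ*-encode i u u≢[] ⟩
    encode (foldl step (decode i) u)     ≡⟨ cong encode (trans (aperiodic _ u _ u≢[] 0<n cycle) (sym cycle)) ⟩
    encode (foldl step (decode i) uⁿ)    ≡⟨ δ*-encode i uⁿ (λ ()) ⟨
    δ* i uⁿ                              ≡⟨ eq ⟩
    i                                    ∎
    where
    open ≡-Reasoning
    uⁿ : Word m
    uⁿ = concat (replicate (suc n) u)
    cycle : foldl step (decode i) uⁿ ≡ decode i
    cycle = trans (sym (decode-δ* i uⁿ)) (cong decode eq)

-- What a continuous reduction forces

module Forcing (em : ExcludedMiddle 0ℓ) {m : ℕ} (M N : Automaton m)
  (h : ωWord m → ωWord m)
  (modulus : ∀ ξ l → ∃ λ n → ∀ {η} → Agree n ξ η → Agree l (h ξ) (h η)) where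

  open Classical em
  private
    module M = Automaton M
    module N = Automaton N
    module MR = Run M
    module NR = Run N

  ρ : ωWord m → ℕ → M.Q
  ρ ξ = MR.run M.init ξ

  ν : ωWord m → ℕ → N.Q
  ν ξ = NR.run N.init (h ξ)

  -- The moment when `read` letters of the input have been read and the first
  -- `written` letters of its image are already determined by them.
  record Position : Set where
    field
      word         : ωWord m
      read written : ℕ
      determined   : ∀ {η} → Agree read word η → Agree written (h word) (h η)

    input  = ρ word read
    output = ν word written

  open Position

  ν-agree : ∀ p {η} → Agree (read p) (word p) η → ∀ {l} → l ≤ written p → ν (word p) l ≡ ν η l
  ν-agree p a = NR.run-agree (determined p a) N.init

  record Follows (S : M.Q → Set) (p : Position) (η : ωWord m) : Set where
    constructor follows
    field
      agree : Agree (read p) (word p) η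
      stay  : ∀ {j} → read p ≤ j → S (ρ η j)

  open Follows

  record Extends (S : M.Q → Set) (p p′ : Position) : Set where
    constructor extends
    field
      continues : Follows S p (word p′)
      read≤     : read p ≤ read p′
      written≤  : written p ≤ written p′

  open Extends

  module _ {S : M.Q → Set} where

    follows-extends : ∀ {p p′ η} → Extends S p p′ → Follows S p′ η → Follows S p η
    follows-extends {p} {p′} {η} e f = follows
      (agree-trans (agree (continues e)) (agree-≤ (read≤ e) (agree f))) stay′
      where
      stay′ : ∀ {j} → read p ≤ j → S (ρ η j)
      stay′ {j} p≤j with ≤-total j (read p′)
      ... | inj₁ j≤p′ = subst S (MR.run-agree (agree f) M.init j≤p′) (stay (continues e) p≤j)
      ... | inj₂ p′≤j = stay f p′≤j

    extends-trans : ∀ {p p′ p″} → Extends S p p′ → Extends S p′ p″ → Extends S p p″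
    extends-trans e e′ = extends (follows-extends e (continues e′))
      (≤-trans (read≤ e) (read≤ e′)) (≤-trans (written≤ e) (written≤ e′))

    extends-refl : ∀ {p} → Follows S p (word p) → Extends S p p
    extends-refl f = extends f ≤-refl ≤-refl

  -- What is written depends only on the letters read, so the unread part of the word may be
  -- exchanged and more of it read.
  redirect : ∀ p η n → Agree (read p) (word p) η → read p ≤ n → Position
  redirect p η n a p≤n = record
    { word = η ; read = n ; written = written p
    ; determined = λ b → agree-trans (agree-sym (determined p a))
                                     (determined p (agree-trans a (agree-≤ p≤n b))) }

  refine : ∀ ξ n l → Position
  refine ξ n l = record
    { word = ξ ; read = n ⊔ proj₁ (modulus ξ l) ; written = l
    ; determined = λ a → proj₂ (modulus ξ l) (agree-≤ (m≤n⊔m n _) a) }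

  -- In game terms: the strategy that h follows from p on wins the game in which the
  -- input has to keep M inside S and the answer has to keep N inside T.
  Confines : (M.Q → Set) → Subset N.size → Position → Set
  Confines S T p = Follows S p (word p)
    × (∀ {η} → Follows S p η → ∀ {l} → written p ≤ l → ν η l ∈ₛ T)

  Win : (M.Q → Set) → Subset N.size → Set
  Win S T = ∃ (Confines S T)

  -- The competitors `U` may win from any position; hence the set that `N` can still visit from a
  -- later position is among them.
  Minimal : (M.Q → Set) → Subset N.size → Set
  Minimal S T = Win S T × (∀ {U} → U ⊆ T → Win S U → T ⊆ U)

  minimize : ∀ {S T} → Win S T → ∃ λ T′ → T′ ⊆ T × Minimal S T′
  minimize {S} w = minimalSubset (Win S) w

  spliceStay : ∀ {S : M.Q → Set} p ζ → (∀ j → S (MR.run (input p) ζ j)) →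
               ∀ {j} → read p ≤ j → S (ρ (splice (word p) (read p) ζ) j)
  spliceStay {S} p ζ stays {j} p≤j = subst (λ i → S (ρ (splice (word p) (read p) ζ) i)) (m+[n∸m]≡n p≤j)
    (subst S (sym (MR.run-splice M.init (word p) (read p) ζ (j ∸ read p))) (stays (j ∸ read p)))

  spliceFollows : ∀ {S : M.Q → Set} p ζ → (∀ j → S (MR.run (input p) ζ j)) →
                  Follows S p (splice (word p) (read p) ζ)
  spliceFollows {S} p ζ stays = follows (splice-agree (word p) (read p) ζ) (spliceStay {S} p ζ stays)

  module _ {S : M.Q → Set} (connected : MR.Connected S) where

    abstract
      -- The finite path to `s` is continued by an input that stays in `S` forever, so the new word
      -- still follows `p`. Nothing is written on the way.
      moveTo : ∀ p → S (input p) → ∀ {s} → S s → ∃ λ p′ →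
        Extends S p p′ × read p < read p′ × written p′ ≡ written p × input p′ ≡ s
      moveTo p here∈ {s} s∈ with connected here∈ s∈
      ... | ζ , l , refl , inside with MR.connected⇒stay connected s∈
      ...   | ζ′ , stays =
        redirect p η (read p + suc l) (agree f) (m≤m+n (read p) (suc l)) ,
        extends f (m≤m+n (read p) (suc l)) ≤-refl ,
        subst (read p <_) (sym (+-suc (read p) l)) (s≤s (m≤m+n (read p) l)) , refl ,
        trans (MR.run-splice M.init (word p) (read p) (splice ζ (suc l) ζ′) (suc l))
              (MR.run-splice-≤ (input p) ζ (suc l) ζ′ ≤-refl)
        where
        η : ωWord m
        η = splice (word p) (read p) (splice ζ (suc l) ζ′)
        stays′ : ∀ j → S (MR.run (input p) (splice ζ (suc l) ζ′) j)
        stays′ j with ≤-total j (suc l)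
        ... | inj₁ j≤l = subst S (sym (MR.run-splice-≤ (input p) ζ (suc l) ζ′ j≤l)) (inside j≤l)
        ... | inj₂ l≤j = subst (λ i → S (MR.run (input p) (splice ζ (suc l) ζ′) i)) (m+[n∸m]≡n l≤j)
          (subst S (sym (MR.run-splice (input p) ζ (suc l) ζ′ (j ∸ suc l))) (stays (j ∸ suc l)))
        f : Follows S p η
        f = spliceFollows p (splice ζ (suc l) ζ′) stays′

      -- The winning position is first led inside `S` to a state of `S′`. Inputs that stay in `S′`
      -- from there on also stay in `S`, so they keep `N` in `T`.
      win-⊆ : ∀ {S′ T s} → MR.Connected S′ → S′ s → (∀ {q} → S′ q → S q) → Win S T → Win S′ T
      win-⊆ {S′} {T} c′ s∈S′ S′⊆S (p , f , confined)
        with moveTo p (stay f ≤-refl) (S′⊆S s∈S′)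
      ... | p′ , e , _ , _ , refl with MR.connected⇒stay c′ s∈S′
      ...   | ζ , stays = p″ , follows (λ _ → refl) (stay f′) , confined″
        where
        f′ : Follows S′ p′ (splice (word p′) (read p′) ζ)
        f′ = spliceFollows p′ ζ stays
        p″ : Position
        p″ = redirect p′ (splice (word p′) (read p′) ζ) (read p′) (agree f′) ≤-refl
        confined″ : ∀ {η} → Follows S′ p″ η → ∀ {l} → written p″ ≤ l → ν η l ∈ₛ T
        confined″ f″ p≤l = confined
          (follows-extends e (follows (agree-trans (agree f′) (agree f″)) (λ p≤j → S′⊆S (stay f″ p≤j))))
          (≤-trans (written≤ e) p≤l)

  -- At every later position the set of the states that N can still visit is itself
  -- winning, so by minimality it is all of T.
  module _ {S : M.Q → Set} {T : Subset N.size} (minimal : Minimal S T) where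
    base : Position
    base = proj₁ (proj₁ minimal)

    follows-base : Follows S base (word base)
    follows-base = proj₁ (proj₂ (proj₁ minimal))

    confined : ∀ {η} → Follows S base η → ∀ {l} → written base ≤ l → ν η l ∈ₛ T
    confined = proj₂ (proj₂ (proj₁ minimal))

    abstract
      stillVisits : ∀ {p} → Extends S base p → ∀ {t} → t ∈ₛ T →
        ∃ λ η → Follows S p η × ∃ λ l → written p ≤ l × ν η l ≡ t
      stillVisits {p} e {t} t∈T = to (∈⟦⟧ Visits t) (proj₂ minimal visits⊆T winVisits t∈T)
        where
        Visits : N.Q → Set
        Visits t = ∃ λ η → Follows S p η × ∃ λ l → written p ≤ l × ν η l ≡ t
        visits⊆T : ⟦ Visits ⟧ ⊆ T
        visits⊆T {t} t∈ with to (∈⟦⟧ Visits t) t∈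
        ... | η , f , l , p≤l , refl = confined (follows-extends e f) (≤-trans (written≤ e) p≤l)
        winVisits : Win S ⟦ Visits ⟧
        winVisits = p ,
          follows (λ _ → refl) (λ p≤j → stay (continues e) (≤-trans (read≤ e) p≤j)) ,
          λ f p≤l → from (∈⟦⟧ Visits _) (_ , f , _ , p≤l , refl)

      forceVisit : ∀ {p} → Extends S base p → ∀ {t} → t ∈ₛ T → ∃ λ p′ →
        Extends S p p′ × read p < read p′ × written p < written p′ × output p′ ≡ t
      -- The visit is requested from a position with one more letter written, which makes it a new
      -- one.
      forceVisit {p} e t∈T with stillVisits (extends-trans e later) t∈T
        where
        later : Extends S p (refine (word p) (read p) (suc (written p)))
        later = extends
          (follows (λ _ → refl) (λ p≤j → stay (continues e) (≤-trans (read≤ e) p≤j)))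
          (m≤m⊔n (read p) _) (n≤1+n _)
      ... | η , f , l , p<l , eq = refine η (suc (read p)) l ,
        extends (follows (agree-≤ (m≤m⊔n (read p) _) (agree f))
                         (λ {j} p≤j → stays p≤j)) 
                (≤-trans (n≤1+n _) (m≤m⊔n (suc (read p)) (proj₁ (modulus η l)))) (<⇒≤ p<l) ,
        m≤m⊔n (suc (read p)) (proj₁ (modulus η l)) , p<l , eq
        where
        stays : ∀ {j} → read p ≤ j → S (ρ η j)
        stays {j} p≤j with ≤-total j (read (refine (word p) (read p) (suc (written p))))
        ... | inj₁ j≤ = subst S (MR.run-agree (agree f) M.init j≤)
                          (stay (continues e) (≤-trans (read≤ e) p≤j))
        ... | inj₂ ≤j = stay f ≤j

      minimal-nonempty : Nonempty T
      minimal-nonempty = _ , confined follows-base ≤-refl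

      -- First `t` and then `t′` is forced. The run of `N` between these moments is a path inside
      -- `T`, nonempty because `forceVisit` writes at least one letter.
      minimal-connected : NR.Connected (_∈ₛ T)
      minimal-connected {t} {t′} t∈ t′∈ with forceVisit (extends-refl follows-base) t∈
      ... | p , e , _ , _ , refl with forceVisit e t′∈
      ...   | p′ , e′ , _ , p<p′ , refl =
        shift (written p) (h (word p′)) , written p′ ∸ suc (written p) ,
        trans (at _) (cong (ν (word p′)) p+[p′∸p]≡p′) ,
        λ {j} _ → subst (_∈ₛ T) (sym (at j))
          (confined (continues (extends-trans e e′)) (≤-trans (written≤ e) (m≤m+n (written p) j)))
        where
        p+[p′∸p]≡p′ : written p + suc (written p′ ∸ suc (written p)) ≡ written p′
        p+[p′∸p]≡p′ = trans (+-suc (written p) _) (m+[n∸m]≡n p<p′)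
        at : ∀ j → NR.run (output p) (shift (written p) (h (word p′))) j ≡ ν (word p′) (written p + j)
        at j = trans
          (cong (λ q → NR.run q (shift (written p) (h (word p′))) j)
                (ν-agree p (agree (continues e′)) ≤-refl))
          (sym (NR.run-shift N.init (h (word p′)) (written p) j))

  Linked : (M.Q → Set) → Subset N.size → Set
  Linked S T = ∃ λ ξ → (∀ q → S q ⇔ Recurs (ρ ξ) q) × (∀ v → v ∈ₛ T ⇔ Recurs (ν ξ) v)

  module _ {S : M.Q → Set} {T : Subset N.size}
           (connected : MR.Connected S) (minimal : Minimal S T) where
    private
      p₀ = base minimal
      f₀ = follows-base minimal

      abstract
        -- The goals enumerate all states cyclically, with those outside `S` replaced by the state
        -- at `p₀`; thus every state of `S` is a goal infinitely often.
        targetˢ : ℕ → Σ M.Q S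
        targetˢ i with em {S (enumerate (input p₀) i)}
        ... | yes s∈ = _ , s∈
        ... | no _   = _ , stay f₀ ≤-refl

        targetᵗ : ℕ → ∃ (_∈ₛ T)
        targetᵗ i with enumerate (output p₀) i ∈ₛ? T
        ... | yes t∈ = _ , t∈
        ... | no _   = _ , confined minimal f₀ ≤-refl

        targetˢ-recurs : ∀ {s} → S s → ∀ n → ∃ λ i → n ≤ i × proj₁ (targetˢ i) ≡ s
        targetˢ-recurs {s} s∈ n with enumerate-recurs (input p₀) s n
        ... | i , n≤i , eq = i , n≤i , hit
          where
          hit : proj₁ (targetˢ i) ≡ s
          hit with em {S (enumerate (input p₀) i)}
          ... | yes _ = eq
          ... | no s∉ = contradiction (subst S (sym eq) s∈) s∉

        targetᵗ-recurs : ∀ {t} → t ∈ₛ T → ∀ n → ∃ λ i → n ≤ i × proj₁ (targetᵗ i) ≡ t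
        targetᵗ-recurs {t} t∈ n with enumerate-recurs (output p₀) t n
        ... | i , n≤i , eq = i , n≤i , hit
          where
          hit : proj₁ (targetᵗ i) ≡ t
          hit with enumerate (output p₀) i ∈ₛ? T
          ... | yes _ = eq
          ... | no t∉ = contradiction (subst (_∈ₛ T) (sym eq) t∈) t∉

      -- One round of the construction: `M` is led to its goal by `moveTo`, then `N` to its own by
      -- `forceVisit`. As both lengths grow strictly, the words converge and the whole image of the
      -- limit is determined.
      record Advance (i : ℕ) (p p′ : Position) : Set where
        constructor advanced
        field
          extension : Extends S p p′
          reads     : read p < read p′
          writes    : written p < written p′
          visitsˢ   : ∃ λ a → read p ≤ a × a ≤ read p′ × ρ (word p′) a ≡ proj₁ (targetˢ i)
          visitsᵗ   : output p′ ≡ proj₁ (targetᵗ i)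

      open Advance

      abstract
        advance : ∀ i p → Extends S p₀ p → ∃ (Advance i p)
        advance i p e
          with moveTo connected p (stay (continues e) (read≤ e)) (proj₂ (targetˢ i))
        ... | p′ , e′ , r′ , w′ , hit
          with forceVisit minimal (extends-trans e e′) (proj₂ (targetᵗ i))
        ...   | p″ , e″ , r″ , w″ , hit″ = p″ , advanced
            (extends-trans e′ e″) (<-trans r′ r″) (subst (_< written p″) w′ w″)
            (read p′ , <⇒≤ r′ , <⇒≤ r″ ,
              trans (sym (MR.run-agree (agree (continues e″)) M.init ≤-refl)) hit)
            hit″

      play : ℕ → ∃ (Extends S p₀)
      play zero    = p₀ , extends-refl f₀
      play (suc i) = proj₁ next , extends-trans (proj₂ (play i)) (extension (proj₂ next))
        where
        next : ∃ (Advance i (proj₁ (play i)))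
        next = advance i (proj₁ (play i)) (proj₂ (play i))

      pos : ℕ → Position
      pos i = proj₁ (play i)

      advances : ∀ i → Advance i (pos i) (pos (suc i))
      advances i = proj₂ (advance i (proj₁ (play i)) (proj₂ (play i)))

      i≤written : ∀ i → i ≤ written (pos i)
      i≤written zero    = z≤n
      i≤written (suc i) = ≤-trans (s≤s (i≤written i)) (writes (advances i))

      agrees : ∀ i → Agree (read (pos i)) (word (pos i)) (word (pos (suc i)))
      agrees i = agree (continues (extension (advances i)))

      ξ : ωWord m
      ξ = limit (word ∘ pos) (read ∘ pos) (λ i → reads (advances i)) agrees

      ξ-agree : ∀ i → Agree (read (pos i)) (word (pos i)) ξ
      ξ-agree = limit-agree (word ∘ pos) (read ∘ pos) (λ i → reads (advances i)) agrees

      i≤read : ∀ i → i ≤ read (pos i)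
      i≤read = i≤ns (word ∘ pos) (read ∘ pos) (λ i → reads (advances i)) agrees

      ξ-follows : Follows S p₀ ξ
      ξ-follows = follows (ξ-agree 0) λ {j} p₀≤j →
        subst S (MR.run-agree (ξ-agree j) M.init (i≤read j))
                (stay (continues (proj₂ (play j))) p₀≤j)

      limitˢ : ∀ q → S q ⇔ Recurs (ρ ξ) q
      limitˢ q = mk⇔ recurs inside
        where
        recurs : S q → Recurs (ρ ξ) q
        recurs q∈ n with targetˢ-recurs q∈ n
        ... | i , n≤i , refl with visitsˢ (advances i)
        ...   | a , i≤a , a≤ , hit =
          a , ≤-trans n≤i (≤-trans (i≤read i) i≤a) ,
          trans (sym (MR.run-agree (ξ-agree (suc i)) M.init a≤)) hit
        inside : Recurs (ρ ξ) q → S q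
        inside r with r (read p₀)
        ... | l , p₀≤l , refl = stay ξ-follows p₀≤l

      limitᵗ : ∀ v → v ∈ₛ T ⇔ Recurs (ν ξ) v
      limitᵗ v = mk⇔ recurs inside
        where
        recurs : v ∈ₛ T → Recurs (ν ξ) v
        recurs v∈ n with targetᵗ-recurs v∈ n
        ... | i , n≤i , refl =
          written (pos (suc i)) , ≤-trans n≤i (≤-trans (n≤1+n i) (i≤written (suc i))) ,
          trans (sym (ν-agree (pos (suc i)) (ξ-agree (suc i)) ≤-refl))
                (visitsᵗ (advances i))
        inside : Recurs (ν ξ) v → v ∈ₛ T
        inside r with r (written p₀)
        ... | l , p₀≤l , refl = confined minimal ξ-follows p₀≤l

    link : Linked S T
    link = ξ , limitˢ , limitᵗ

-- Concatenation of a sequence of words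

module _ {m : ℕ} (d : Fin m) where

  nth : Word m → ℕ → Fin m
  nth []      _       = d
  nth (x ∷ _) zero    = x
  nth (_ ∷ l) (suc j) = nth l j

  nth-↾ : ∀ l → nth l ↾ length l ≡ l
  nth-↾ []      = refl
  nth-↾ (x ∷ l) = cong (x ∷_) (nth-↾ l)

  nth-++ˡ : ∀ l {r j} → j < length l → nth (l ++ r) j ≡ nth l j
  nth-++ˡ (x ∷ l) {j = zero}  _       = refl
  nth-++ˡ (x ∷ l) {j = suc j} (s≤s p) = nth-++ˡ l p

  nth-++ʳ : ∀ l {r} j → nth (l ++ r) (length l + j) ≡ nth r j
  nth-++ʳ []      j = refl
  nth-++ʳ (x ∷ l) j = nth-++ʳ l j

  nth-prefix : ∀ (ζ : ωWord m) {n j} → j < n → nth (ζ ↾ n) j ≡ ζ j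
  nth-prefix ζ {suc n} {zero}  _       = refl
  nth-prefix ζ {suc n} {suc j} (s≤s p) = nth-prefix (ζ ∘ suc) p

  module Concatenation (ws : ℕ → Word m) where

    upto : ℕ → Word m
    upto n = concat (applyUpTo ws n)

    upto-suc : ∀ n → upto (suc n) ≡ upto n ++ ws n
    upto-suc n = begin
      concat (applyUpTo ws (suc n))            ≡⟨ cong concat (applyUpTo-∷ʳ ws n) ⟨
      concat (applyUpTo ws n ∷ʳ ws n)          ≡⟨ concat-++ (applyUpTo ws n) [ ws n ] ⟨
      upto n ++ (ws n ++ [])                   ≡⟨ cong (upto n ++_) (++-identityʳ (ws n)) ⟩
      upto n ++ ws n                           ∎
      where open ≡-Reasoning

    length-upto-suc : ∀ n → length (upto (suc n)) ≡ length (upto n) + length (ws n)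
    length-upto-suc n = trans (cong length (upto-suc n)) (length-++ (upto n))

    length-upto-mono : ∀ n k → length (upto n) ≤ length (upto (k + n))
    length-upto-mono n zero    = ≤-refl
    length-upto-mono n (suc k) = ≤-trans (length-upto-mono n k)
      (subst (length (upto (k + n)) ≤_) (sym (length-upto-suc (k + n))) (m≤m+n _ _))

    private
      nth-later : ∀ n k {j} → j < length (upto n) → nth (upto (k + n)) j ≡ nth (upto n) j
      nth-later n zero    j< = refl
      nth-later n (suc k) j< = trans (cong (λ l → nth l _) (upto-suc (k + n)))
        (trans (nth-++ˡ (upto (k + n)) (<-≤-trans j< (length-upto-mono n k))) (nth-later n k j<))

      nth-≤ : ∀ {n n′ j} → n ≤ n′ → j < length (upto n) → nth (upto n′) j ≡ nth (upto n) j
      nth-≤ {n} {n′} n≤n′ j< =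
        trans (cong (λ i → nth (upto i) _) (sym (m∸n+n≡m n≤n′))) (nth-later n (n′ ∸ n) j<)

    module _ (unbounded : ∀ l → ∃ λ n → l ≤ length (upto n)) where

      infinite : ωWord m
      infinite j = nth (upto (proj₁ (unbounded (suc j)))) j

      infinite-agree : ∀ n → Agree (length (upto n)) infinite (nth (upto n))
      infinite-agree n {j} j< with ≤-total n (proj₁ (unbounded (suc j)))
      ... | inj₁ n≤ = nth-≤ n≤ j<
      ... | inj₂ ≤n = sym (nth-≤ ≤n (proj₂ (unbounded (suc j))))

      infinite-↾ : ∀ n → upto n ≡ infinite ↾ length (upto n)
      infinite-↾ n = sym (trans (agree⇒↾ _ (infinite-agree n)) (nth-↾ (upto n)))

      infinite-shift : ∀ n → Agree (length (ws n)) (shift (length (upto n)) infinite) (nth (ws n))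
      infinite-shift n {j} j< = begin
        infinite (length (upto n) + j)
          ≡⟨ infinite-agree (suc n) (subst (length (upto n) + j <_) (sym (length-upto-suc n))
               (+-monoʳ-< (length (upto n)) j<)) ⟩
        nth (upto (suc n)) (length (upto n) + j)
          ≡⟨ cong (λ l → nth l (length (upto n) + j)) (upto-suc n) ⟩
        nth (upto n ++ ws n) (length (upto n) + j)
          ≡⟨ nth-++ʳ (upto n) j ⟩
        nth (ws n) j ∎
        where open ≡-Reasoning

      -- Finds the block of output that contains position `l`. The counter `k` bounds the search by
      -- a stage at which the output is known to be long enough.
      block : ∀ n {l} → length (upto n) ≤ l →
              ∃ λ n′ → n ≤ n′ × length (upto n′) ≤ l × l ≤ length (upto (suc n′))
      block n {l} n≤l = search (proj₁ (unbounded l)) n ≤-refl n≤l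
                          (≤-trans (proj₂ (unbounded l)) later)
        where
        later : length (upto (proj₁ (unbounded l))) ≤ length (upto (proj₁ (unbounded l) + n))
        later = subst (λ i → length (upto (proj₁ (unbounded l))) ≤ length (upto i))
          (+-comm n (proj₁ (unbounded l))) (length-upto-mono (proj₁ (unbounded l)) n)
        search : ∀ k i → n ≤ i → length (upto i) ≤ l → l ≤ length (upto (k + i)) →
                 ∃ λ n′ → n ≤ n′ × length (upto n′) ≤ l × l ≤ length (upto (suc n′))
        search zero    i n≤i i≤l l≤ = i , n≤i , i≤l ,
          ≤-trans l≤ (length-upto-mono i 1)
        search (suc k) i n≤i i≤l l≤ with ≤-total l (length (upto (suc i)))
        ... | inj₁ l≤i = i , n≤i , i≤l , l≤i
        ... | inj₂ i≤l′ = search k (suc i) (m≤n⇒m≤1+n n≤i) i≤l′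
                            (subst (λ j → l ≤ length (upto j)) (sym (+-suc k i)) l≤)

-- The transducer

module Strategy (em : ExcludedMiddle 0ℓ) {m : ℕ} (M N : Automaton m)
  (h : ωWord m → ωWord m)
  (modulus : ∀ ξ l → ∃ λ n → ∀ {η} → Agree n ξ η → Agree l (h ξ) (h η))
  (letter : Fin m) where

  open Classical em
  open Forcing em M N h modulus
  open Position
  open Follows
  open Extends
  private
    module M = Automaton M
    module N = Automaton N
    module MR = Run M
    module NR = Run N

  -- Here `d` is the state of `N` under the transducer's output. It need not be the state that `h`
  -- produces; being able to catch up with it suffices, since limit sets do not depend on finite
  -- prefixes.
  Ok : M.Q → N.Q → Set
  Ok q d = ∃ λ p → input p ≡ q × NR.Reach d (output p)

  ok-step : ∀ {q d} x → Ok q d → Ok (M.δ q x) d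
  ok-step {q} {d} x (p , refl , reach) = p′ ,
    trans (cong (ρ η) (+-comm 1 (read p))) (MR.run-splice M.init (word p) (read p) (λ _ → x) 1) ,
    subst (NR.Reach d) (ν-agree p (splice-agree (word p) (read p) (λ _ → x)) ≤-refl) reach
    where
    η : ωWord m
    η = splice (word p) (read p) (λ _ → x)
    p′ : Position
    p′ = redirect p η (suc (read p)) (splice-agree (word p) (read p) (λ _ → x)) (n≤1+n _)

  _≈_ : M.Q → M.Q → Set
  q ≈ r = MR.Reach q r × MR.Reach r q

  -- While M stays in the strongly connected component of q, having entered it
  -- when N was in state d, N is kept in D.
  record Home (q : M.Q) (d : N.Q) (D : Subset N.size) : Set where
    field
      strong  : MR.Connected (q ≈_)
      minimal : Minimal (q ≈_) D
      reach   : ∀ {v} → v ∈ₛ D → NR.Reach d v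

  module _ {q d D} (home : Home q d D) where
    open Home home

    -- `moveTo` leads the base position to `r` while its output state stays in `D`. As `D` is
    -- connected, that state can be reached from every `v` in `D`, so `N` may leave from anywhere in
    -- `D`.
    home-ok : ∀ {r v} → q ≈ r → v ∈ₛ D → Ok r v
    home-ok {r} {v} q≈r v∈ with moveTo strong (base minimal) (stay (follows-base minimal) ≤-refl) q≈r
    ... | p , e , _ , w , eq = p , eq ,
      NR.connected⇒reach (minimal-connected minimal) v∈
        (confined minimal (continues e) (≤-reflexive (sym w)))

    home-win : ∀ {S s} → MR.Connected S → S s → (∀ {r} → S r → q ≈ r) → Win S D
    home-win c s∈ S⊆ = win-⊆ strong c s∈ S⊆ (proj₁ minimal)

  module _ {q₀ q : M.Q} {x : Fin m} (q₀≈q : q₀ ≈ q) (q₀≈δ : q₀ ≈ M.δ q x) where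

    -- Every path is routed through the transition from `q` by `x`, which makes it nonempty. A state
    -- on a path between two members of the component is itself a member.
    component-connected : MR.Connected (q₀ ≈_)
    component-connected {s} {s′} q₀≈s q₀≈s′
      with MR.reach-trans (proj₂ q₀≈s) (proj₁ q₀≈q)
         | MR.reach-trans (proj₂ q₀≈δ) (proj₁ q₀≈s′)
    ... | ζ , l , refl | ζ′ , l′ , refl = η , l + l′ , ends , λ {j} j≤ →
      MR.reach-trans (proj₁ q₀≈s) (MR.reach-run s η {0} {j} z≤n) ,
      MR.reach-trans (subst (MR.Reach (MR.run s η j)) ends (MR.reach-run s η j≤)) (proj₂ q₀≈s′)
      where
      ζx : ωWord m
      ζx = splice (λ _ → x) 1 ζ′
      η : ωWord m
      η = splice ζ l ζx
      ends : MR.run s η (suc (l + l′)) ≡ s′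
      ends = trans (cong (MR.run s η) (sym (+-suc l l′)))
        (trans (MR.run-splice s ζ l ζx (suc l′)) (MR.run-splice _ (λ _ → x) 1 ζ′ l′))

    -- From the position given by `Ok`, `N` can only visit states reachable from `d`. The set of
    -- these is therefore winning, and a minimal winning subset serves as home.
    home-exists : ∀ {d} → Ok q₀ d → ∃ (Home q₀ d)
    home-exists {d} (p , refl , reach)
      with MR.connected⇒stay component-connected (MR.reach-refl (word p) , MR.reach-refl (word p))
    ... | ζ , stays with minimize (p′ , follows (λ _ → refl) (stay f) , confined′)
      where
      f : Follows (q₀ ≈_) p (splice (word p) (read p) ζ)
      f = spliceFollows p ζ stays
      p′ : Position
      p′ = redirect p (splice (word p) (read p) ζ) (read p) (agree f) ≤-refl
      confined′ : ∀ {η} → Follows (q₀ ≈_) p′ η → ∀ {l} → written p ≤ l → ν η l ∈ₛ ⟦ NR.Reach d ⟧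
      confined′ {η} f′ {l} p≤l = from (∈⟦⟧ (NR.Reach d) _) (NR.reach-trans
        (subst (NR.Reach d) (ν-agree p (agree-trans (agree f) (agree f′)) ≤-refl) reach)
        (NR.reach-run N.init (h η) p≤l))
    ...   | D , D⊆ , minimal = D , record
      { strong = component-connected ; minimal = minimal
      ; reach = λ v∈ → to (∈⟦⟧ (NR.Reach d) _) (D⊆ v∈) }

  abstract
    -- The choice depends on `q` and `d` alone and not on a proof, so equal memories give equal
    -- sets; `⊥` is only a default.
    dwelling : M.Q → N.Q → Subset N.size
    dwelling q d with em {∃ (Home q d)}
    ... | yes (D , _) = D
    ... | no _        = ⊥

    dwelling-home : ∀ {q d} → ∃ (Home q d) → Home q d (dwelling q d)
    dwelling-home {q} {d} home with em {∃ (Home q d)}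
    ... | yes (_ , home′) = home′
    ... | no ¬home        = contradiction home ¬home

    -- A tail of the recency list need not have a connected complement. In such a case `T` is passed
    -- on unchanged, so connectedness and nonemptiness survive along all tails.
    narrow : (M.Q → Set) → Subset N.size → Subset N.size
    narrow S T with em {MR.Connected S × Win S T}
    ... | yes (_ , w) = proj₁ (minimize w)
    ... | no _        = T

    narrow-⊆ : ∀ S T → narrow S T ⊆ T
    narrow-⊆ S T with em {MR.Connected S × Win S T}
    ... | yes (_ , w) = proj₁ (proj₂ (minimize w))
    ... | no _        = ⊆-refl

    narrow-minimal : ∀ {S T} → MR.Connected S → Win S T → Minimal S (narrow S T)
    narrow-minimal {S} {T} c w with em {MR.Connected S × Win S T}
    ... | yes (_ , w′) = proj₂ (proj₂ (minimize w′))
    ... | no ¬cw       = contradiction ((λ {_} {_} → c) , w) ¬cw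

    narrow-connected : ∀ S {T} → NR.Connected (_∈ₛ T) → NR.Connected (_∈ₛ narrow S T)
    narrow-connected S {T} c with em {MR.Connected S × Win S T}
    ... | yes (_ , w) = minimal-connected (proj₂ (proj₂ (minimize w)))
    ... | no _        = c

    narrow-nonempty : ∀ S {T} → Nonempty T → Nonempty (narrow S T)
    narrow-nonempty S {T} ne with em {MR.Connected S × Win S T}
    ... | yes (_ , w) = minimal-nonempty (proj₂ (proj₂ (minimize w)))
    ... | no _        = ne

    -- The narrowed set still wins for the larger `S`, hence by `win-⊆` for `S′`. Narrowing for an
    -- intermediate tail thus never spoils a later choice.
    narrow-win : ∀ {S S′ s T} → MR.Connected S′ → S′ s → (∀ {q} → S′ q → S q) →
                 Win S′ T → Win S′ (narrow S T)
    narrow-win {S} {T = T} c′ s∈ S′⊆S w′ with em {MR.Connected S × Win S T}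
    ... | yes (c , w) = win-⊆ c c′ s∈ S′⊆S (proj₁ (proj₂ (proj₂ (minimize w))))
    ... | no _        = w′

  -- If the tail t of the recency list consists of the states seen least recently,
  -- the input is currently confined to the complement of t; so the longer the
  -- tail, the smaller the set in which N is kept.
  confine : Subset N.size → List M.Q → Subset N.size
  confine D []      = narrow (_∉ []) D
  confine D (q ∷ t) = narrow (_∉ (q ∷ t)) (confine D t)

  module _ (D : Subset N.size) where

    confine-⊆ : ∀ t → confine D t ⊆ D
    confine-⊆ []      = narrow-⊆ _ D
    confine-⊆ (q ∷ t) v∈ = confine-⊆ t (narrow-⊆ _ _ v∈)

    confine-++ : ∀ xs {t} → confine D (xs ++ t) ⊆ confine D t
    confine-++ []       v∈ = v∈
    confine-++ (x ∷ xs) v∈ = confine-++ xs (narrow-⊆ _ _ v∈)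

    confine-connected : NR.Connected (_∈ₛ D) → ∀ t → NR.Connected (_∈ₛ confine D t)
    confine-connected c []      = narrow-connected _ c
    confine-connected c (q ∷ t) = narrow-connected _ (confine-connected c t)

    confine-nonempty : Nonempty D → ∀ t → Nonempty (confine D t)
    confine-nonempty ne []      = narrow-nonempty _ ne
    confine-nonempty ne (q ∷ t) = narrow-nonempty _ (confine-nonempty ne t)

    confine-win : ∀ {S s} → MR.Connected S → S s → Win S D →
                  ∀ t → (∀ {q} → S q → q ∉ t) → Win S (confine D t)
    confine-win c s∈ w []      S⊆ = narrow-win c s∈ S⊆ w
    confine-win c s∈ w (q ∷ t) S⊆ =
      narrow-win c s∈ S⊆ (confine-win c s∈ w t (λ r∈ r∈t → S⊆ r∈ (there r∈t)))

    -- The last narrowing is the one for `_∉ t` itself, and `confine-win` shows that the earlier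
    -- ones have left a winning set.
    confine-minimal : ∀ t {s} → s ∉ t → MR.Connected (_∉ t) → Win (_∉ t) D →
                      Minimal (_∉ t) (confine D t)
    confine-minimal []      s∉ c w = narrow-minimal c w
    confine-minimal (q ∷ t) s∉ c w =
      narrow-minimal c (confine-win c s∉ w t (λ r∉ r∈t → r∉ (there r∈t)))

  -- `entry` is the state in which the current strongly connected component was
  -- entered and `exit` the state of N at that moment; N stays there as long as
  -- the memory is `fresh`.
  record State : Set where
    constructor state
    field
      cur entry : M.Q
      exit      : N.Q
      fresh     : Bool
      recent    : List M.Q

  open State
  open Recency {M.size}

  next : State → Fin m → M.Q
  next s x = M.δ (cur s) x

  home : State → Subset N.size
  home s = dwelling (entry s) (exit s)

  pick : Subset N.size → N.Q → N.Q
  pick T d with nonempty? T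
  ... | yes (v , _) = v
  ... | no _        = d

  pick-∈ : ∀ {T d} → Nonempty T → pick T d ∈ₛ T
  pick-∈ {T} ne with nonempty? T
  ... | yes (_ , v∈) = v∈
  ... | no empty     = contradiction ne empty

  -- Every answer ends in this chosen state, so the memory need not record where `N` is. A fresh
  -- memory means that nothing has been written since the component was entered.
  locate : State → N.Q
  locate (state _ e d true  l) = d
  locate (state _ e d false l) = pick (confine (dwelling e d) l) d

  Returns : State → Fin m → Set
  Returns s x = MR.Reach (next s x) (cur s)

  -- The decision is an argument so that both cases can be treated by matching before `em` is
  -- inserted.
  move : ∀ s x → Dec (Returns s x) → State
  move s x (yes _) = state (next s x) (entry s) (exit s) false (moveToFront (recent s) (next s x))
  -- `M` has left its component for good. The current state of `N` becomes the new `exit`, and `N`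
  -- waits there.
  move s x (no _)  = state (next s x) (next s x) (locate s) true (moveToFront (recent s) (next s x))

  step : State → Fin m → State
  step s x = move s x em

  cur-step : ∀ s x → cur (step s x) ≡ next s x
  cur-step s x with em {Returns s x}
  ... | yes _ = refl
  ... | no _  = refl

  recent-step : ∀ s x → recent (step s x) ≡ moveToFront (recent s) (next s x)
  recent-step s x with em {Returns s x}
  ... | yes _ = refl
  ... | no _  = refl

  record Stays (s s′ : State) : Set where
    field
      entry-≡ : entry s′ ≡ entry s
      exit-≡  : exit s′ ≡ exit s
      settled : fresh s′ ≡ false

  open Stays

  step-stays : ∀ {s x} → Returns s x → Stays s (step s x)
  step-stays {s} {x} returns with em {Returns s x}
  ... | yes _ = record { entry-≡ = refl ; exit-≡ = refl ; settled = refl }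
  ... | no ¬r = contradiction returns ¬r

  stays-trans : ∀ {s s′ s″} → Stays s s′ → Stays s′ s″ → Stays s s″
  stays-trans a b = record
    { entry-≡ = trans (entry-≡ b) (entry-≡ a) ; exit-≡ = trans (exit-≡ b) (exit-≡ a)
    ; settled = settled b }

  record Inv (s : State) : Set where
    field
      unique   : Unique (recent s)
      complete : ∀ q → q ∈ₗ recent s
      near     : entry s ≈ cur s
      ok       : Ok (entry s) (exit s)
      arrived  : fresh s ≡ true → cur s ≡ entry s
      at-home  : fresh s ≡ false → Home (entry s) (exit s) (home s)

  open Inv

  locate-∈ : ∀ {s} → Inv s → fresh s ≡ false → locate s ∈ₛ confine (home s) (recent s)
  locate-∈ {state _ e d false l} inv refl =
    pick-∈ (confine-nonempty _ (minimal-nonempty (Home.minimal (at-home inv refl))) l)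

  locate-ok : ∀ {s} → Inv s → Ok (cur s) (locate s)
  locate-ok {state q e d true  l} inv = subst (λ r → Ok r d) (sym (arrived inv refl)) (ok inv)
  locate-ok {s@(state q e d false l)} inv =
    home-ok (at-home inv refl) (near inv) (confine-⊆ _ l (locate-∈ {s} inv refl))

  move-inv : ∀ {s} x d → Inv s → Inv (move s x d)
  move-inv {s} x (yes returns) inv = record
    { unique = moveToFront-unique (unique inv)
    ; complete = λ q → moveToFront-∈ (complete inv q)
    ; near = near′
    ; ok = ok inv
    ; arrived = λ ()
    ; at-home = λ _ → dwelling-home (home-exists (near inv) near′ (ok inv))
    }
    where
    near′ : entry s ≈ next s x
    near′ = MR.reach-trans (proj₁ (near inv)) (MR.reach-δ (cur s) x) ,
            MR.reach-trans returns (proj₂ (near inv))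
  move-inv {s} x (no _) inv = record
    { unique = moveToFront-unique (unique inv)
    ; complete = λ q → moveToFront-∈ (complete inv q)
    ; near = MR.reach-refl (λ _ → letter) , MR.reach-refl (λ _ → letter)
    ; ok = ok-step x (locate-ok inv)
    ; arrived = λ _ → refl
    ; at-home = λ ()
    }

  step-inv : ∀ {s} x → Inv s → Inv (step s x)
  step-inv x = move-inv x em

  start : State
  start = state M.init M.init N.init true (allFin M.size)

  start-inv : Inv start
  start-inv = record
    { unique = Unique.allFin⁺ M.size
    ; complete = ∈-allFin
    ; near = MR.reach-refl (λ _ → letter) , MR.reach-refl (λ _ → letter)
    ; ok = record { word = λ _ → letter ; read = 0 ; written = 0 ; determined = λ _ () } ,
           refl , NR.reach-refl (λ _ → letter)
    ; arrived = λ _ → refl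
    ; at-home = λ ()
    }

  states : List State
  states = map (λ { (q , e , d , b , l) → state q e d b l })
    (cartesianProduct (allFin M.size) (cartesianProduct (allFin M.size)
      (cartesianProduct (allFin N.size) (cartesianProduct (true ∷ false ∷ [])
        (listsUpTo M.size M.size)))))

  ∈-states : ∀ {s} → Inv s → s ∈ₗ states
  ∈-states {s} inv = ∈-map⁺ _ (∈-cartesianProduct⁺ (∈-allFin (cur s))
    (∈-cartesianProduct⁺ (∈-allFin (entry s)) (∈-cartesianProduct⁺ (∈-allFin (exit s))
      (∈-cartesianProduct⁺ (bool (fresh s)) (∈-listsUpTo (recent s) (unique⇒length≤ (unique inv)))))))
    where
    bool : ∀ b → b ∈ₗ (true ∷ false ∷ [])
    bool true  = here refl
    bool false = there (here refl)

  module R = Realize em step Inv step-inv start start-inv states ∈-states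

  -- Between two visits to q′ the automaton M stays outside `after q′ l`; N answers
  -- the second visit by touring the whole set in which that stay confines it.
  Answer : (s : State) (x : Fin m) → State → Set
  Answer s x s′ = ∃ λ ζ → ∃ λ l → NR.run (locate s) ζ l ≡ locate s′
    × (Returns s x → fresh s ≡ false →
       NR.Covers (confine (home s) (after (next s x) (recent s))) (locate s) ζ l)

  answerMove : ∀ {s} x d → Inv s → Answer s x (move s x d)
  answerMove x (no ¬r) inv = (λ _ → x) , 0 , refl , λ returns → contradiction returns ¬r
  -- The first step inside the component: `N` travels from `exit` into its home, and no tour is due
  -- yet.
  answerMove {s@(state q e d true l)} x (yes r) inv with
    Home.reach (at-home inv′ refl) (confine-⊆ _ (recent s′) (locate-∈ inv′ refl))
    where
    s′ = move s x (yes r)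
    inv′ : Inv s′
    inv′ = move-inv x (yes r) inv
  ... | ζ , k , eq = ζ , k , eq , λ _ ()
  answerMove {s@(state q e d false l)} x (yes r) inv =
    let ζ , k , eq , covers = NR.cover (confine-connected (home s)
                                (minimal-connected (Home.minimal (at-home inv refl))) t) here∈ there∈
    in ζ , k , eq , λ _ _ → covers
    where
    t : List M.Q
    t = after (next s x) l
    inv′ : Inv (move s x (yes r))
    inv′ = move-inv x (yes r) inv
    here∈ : locate s ∈ₛ confine (home s) t
    here∈ with after-suffix l (complete inv (next s x))
    ... | ys , eq = confine-++ (home s) ys
      (subst (λ l′ → locate s ∈ₛ confine (home s) l′) eq (locate-∈ {s} inv refl))
    there∈ : locate (move s x (yes r)) ∈ₛ confine (home s) t
    there∈ with moveToFront-after l (complete inv (next s x))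
    ... | ys , eq = confine-++ (home s) ys
      (subst (λ l′ → locate (move s x (yes r)) ∈ₛ confine (home s) l′) eq
             (locate-∈ {move s x (yes r)} inv′ refl))

  abstract
    answer : ∀ {s} → Inv s → ∀ x → Answer s x (step s x)
    answer inv x = answerMove x em inv

  -- Aperiodicity of the memory

  trace : M.Q → Word m → List M.Q
  trace q []      = []
  trace q (x ∷ u) = M.δ q x ∷ trace (M.δ q x) u

  trace-++ : ∀ q u w → trace q (u ++ w) ≡ trace q u ++ trace (M.δ* q u) w
  trace-++ q []      w = refl
  trace-++ q (x ∷ u) w = cong (M.δ q x ∷_) (trace-++ (M.δ q x) u w)

  trace-replicate : ∀ n q u → M.δ* q u ≡ q →
                    trace q (concat (replicate n u)) ≡ concat (replicate n (trace q u))
  trace-replicate zero    q u eq = refl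
  trace-replicate (suc n) q u eq = trans (trace-++ q u _) (cong (trace q u ++_)
    (trans (cong (λ r → trace r (concat (replicate n u))) eq) (trace-replicate n q u eq)))

  cur-steps : ∀ u s → cur (foldl step s u) ≡ M.δ* (cur s) u
  cur-steps []      s = refl
  cur-steps (x ∷ u) s = trans (cur-steps u (step s x)) (cong (λ q → M.δ* q u) (cur-step s x))

  recent-steps : ∀ u s → recent (foldl step s u) ≡ visit (recent s) (trace (cur s) u)
  recent-steps []      s = refl
  recent-steps (x ∷ u) s = trans (recent-steps u (step s x))
    (cong₂ (λ l q → visit l (trace q u)) (recent-step s x) (cur-step s x))

  reach-δ* : ∀ q u → MR.Reach q (M.δ* q u)
  reach-δ* q []      = MR.reach-refl (λ _ → letter)
  reach-δ* q (x ∷ u) = MR.reach-trans (MR.reach-δ q x) (reach-δ* (M.δ q x) u)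

  -- If the end of the word leads back to its beginning, then each single step can be undone as
  -- well, so the component is never left.
  steps-stay : ∀ x u s → MR.Reach (M.δ* (cur s) (x ∷ u)) (cur s) → Stays s (foldl step s (x ∷ u))
  steps-stay x []      s back = step-stays back
  steps-stay x (y ∷ u) s back = stays-trans
    (step-stays (MR.reach-trans (reach-δ* (next s x) (y ∷ u)) back))
    (steps-stay y u (step s x) (subst (λ q → MR.Reach (M.δ* q (y ∷ u)) q) (sym (cur-step s x))
      (MR.reach-trans back (MR.reach-δ (cur s) x))))

  state-≡ : ∀ {s s′} → cur s ≡ cur s′ → entry s ≡ entry s′ → exit s ≡ exit s′ →
            fresh s ≡ fresh s′ → recent s ≡ recent s′ → s ≡ s′
  state-≡ refl refl refl refl refl = refl

  -- Aperiodicity of `M` gives that `u` fixes `cur s`. Hence neither `u` nor its power leaves the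
  -- component, and `entry` and `exit` persist; `fresh s` is already `false`, as `s` is also the
  -- state after the power. The recency list is settled by `visit-replicate`.
  step-aperiodic : M.Aperiodic → ∀ s u n → u ≢ [] → 0 < n →
                   foldl step s (concat (replicate n u)) ≡ s → foldl step s u ≡ s
  step-aperiodic aperiodic s []          _       u≢[] _   _     = contradiction refl u≢[]
  step-aperiodic aperiodic s u@(x ∷ u′) (suc n) u≢[] 0<n cycle =
    state-≡ (trans (cur-steps u s) once) (entry-≡ stays) (exit-≡ stays)
      (trans (settled stays) (sym (trans (cong fresh (sym cycle)) (settled staysⁿ))))
      (begin
        recent (foldl step s u)                                   ≡⟨ recent-steps u s ⟩
        visit (recent s) (trace (cur s) u)                        ≡⟨ visit-replicate n (trace (cur s) u) (recent s) ⟨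
        visit (recent s) (concat (replicate (suc n) (trace (cur s) u)))
          ≡⟨ cong (visit (recent s)) (trace-replicate (suc n) (cur s) u once) ⟨
        visit (recent s) (trace (cur s) uⁿ)                       ≡⟨ recent-steps uⁿ s ⟨
        recent (foldl step s uⁿ)                                  ≡⟨ cong recent cycle ⟩
        recent s                                                  ∎)
    where
    open ≡-Reasoning
    uⁿ : Word m
    uⁿ = concat (replicate (suc n) u)
    curⁿ : M.δ* (cur s) uⁿ ≡ cur s
    curⁿ = trans (sym (cur-steps uⁿ s)) (cong cur cycle)
    once : M.δ* (cur s) u ≡ cur s
    once = aperiodic (cur s) u (suc n) u≢[] 0<n curⁿ
    returning : ∀ {q} → q ≡ cur s → MR.Reach q (cur s)
    returning refl = MR.reach-refl (λ _ → letter)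
    stays : Stays s (foldl step s u)
    stays = steps-stay x u′ s (returning once)
    staysⁿ : Stays s (foldl step s uⁿ)
    staysⁿ = steps-stay x (u′ ++ concat (replicate n u)) s (returning curⁿ)

  -- The play on one input

  module Play (ξ : ωWord m) (σ : ℕ → State) (σ-inv : ∀ n → Inv (σ n)) (σ-zero : σ 0 ≡ start)
    (σ-suc : ∀ n → σ (suc n) ≡ step (σ n) (ξ n))
    (answers : ∀ n → Answer (σ n) (ξ n) (step (σ n) (ξ n))) where

    cur-σ : ∀ n → cur (σ n) ≡ ρ ξ n
    cur-σ zero    = cong cur σ-zero
    cur-σ (suc n) = trans (cong cur (σ-suc n))
      (trans (cur-step (σ n) (ξ n)) (cong (λ q → M.δ q (ξ n)) (cur-σ n)))

    next-σ : ∀ n → next (σ n) (ξ n) ≡ ρ ξ (suc n)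
    next-σ n = cong (λ q → M.δ q (ξ n)) (cur-σ n)

    recent-σ : ∀ n → recent (σ (suc n)) ≡ moveToFront (recent (σ n)) (ρ ξ (suc n))
    recent-σ n = trans (cong recent (σ-suc n))
      (trans (recent-step (σ n) (ξ n)) (cong (moveToFront (recent (σ n))) (next-σ n)))

    response : ℕ → ωWord m
    response n = proj₁ (answers n)

    amount : ℕ → ℕ
    amount n = proj₁ (proj₂ (answers n))

    open Concatenation letter (λ n → response n ↾ amount n)

    S : M.Q → Set
    S = Recurs (ρ ξ)

    private
      recurrence = eventuallyRecurrent (ρ ξ)

      n₁ n₂ : ℕ
      n₁ = proj₁ recurrence
      -- One step after `M` has begun to visit only states of `S`, the memory is no longer fresh and
      -- the home is fixed.
      n₂ = suc n₁

      S-from : ∀ {n} → n₁ ≤ n → S (ρ ξ n)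
      S-from = proj₂ recurrence

      S-connected : MR.Connected S
      S-connected = recurrent-connected M ξ n₁ S-from

      returns : ∀ {n} → n₁ ≤ n → Returns (σ n) (ξ n)
      returns {n} n₁≤n with S-from n₁≤n (suc n)
      ... | l , n<l , eq = subst (λ q → MR.Reach q (cur (σ n))) (sym (next-σ n))
        (subst (MR.Reach (ρ ξ (suc n))) (trans eq (sym (cur-σ n))) (MR.reach-run M.init ξ n<l))

      stays-suc : ∀ {n} → n₁ ≤ n → Stays (σ n) (σ (suc n))
      stays-suc {n} n₁≤n = subst (Stays (σ n)) (sym (σ-suc n)) (step-stays (returns n₁≤n))

      stays-later : ∀ k → Stays (σ n₂) (σ (k + n₂))
      stays-later zero    = record
        { entry-≡ = refl ; exit-≡ = refl ; settled = settled (stays-suc {n₁} ≤-refl) }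
      stays-later (suc k) = stays-trans (stays-later k)
        (stays-suc (≤-trans (n≤1+n n₁) (m≤n+m n₂ k)))

      stays : ∀ {n} → n₂ ≤ n → Stays (σ n₂) (σ n)
      stays {n} n₂≤n = subst (λ i → Stays (σ n₂) (σ i)) (m∸n+n≡m n₂≤n) (stays-later (n ∸ n₂))

      D : Subset N.size
      D = home (σ n₂)

      home-σ : ∀ {n} → n₂ ≤ n → home (σ n) ≡ D
      home-σ n₂≤n = cong₂ dwelling (entry-≡ (stays n₂≤n)) (exit-≡ (stays n₂≤n))

      settledHome : Home (entry (σ n₂)) (exit (σ n₂)) D
      settledHome = at-home (σ-inv n₂) (settled (stays ≤-refl))

      visited : ℕ → List M.Q
      visited k = applyUpTo (λ j → ρ ξ (suc (j + n₂))) k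

      recent-later : ∀ k → recent (σ (k + n₂)) ≡ visit (recent (σ n₂)) (visited k)
      recent-later zero    = refl
      recent-later (suc k) = begin
        recent (σ (suc (k + n₂)))
          ≡⟨ recent-σ (k + n₂) ⟩
        moveToFront (recent (σ (k + n₂))) (ρ ξ (suc (k + n₂)))
          ≡⟨ cong (λ l → moveToFront l (ρ ξ (suc (k + n₂)))) (recent-later k) ⟩
        moveToFront (visit (recent (σ n₂)) (visited k)) (ρ ξ (suc (k + n₂)))
          ≡⟨ foldl-∷ʳ moveToFront (recent (σ n₂)) _ (visited k) ⟨
        visit (recent (σ n₂)) (visited k ∷ʳ ρ ξ (suc (k + n₂)))
          ≡⟨ cong (visit (recent (σ n₂))) (applyUpTo-∷ʳ (λ j → ρ ξ (suc (j + n₂))) k) ⟩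
        visit (recent (σ n₂)) (visited (suc k)) ∎
        where open ≡-Reasoning

      allVisited : ∃ λ k → ∀ q → S q → q ∈ₗ visited k
      allVisited = uniformBound (λ q k → S q → q ∈ₗ visited k) mono bound
        where
        mono : ∀ {q j k} → j ≤ k → (S q → q ∈ₗ visited j) → S q → q ∈ₗ visited k
        mono j≤k vis q∈ with ∈-applyUpTo⁻ _ (vis q∈)
        ... | i , i<j , refl = ∈-applyUpTo⁺ _ (<-≤-trans i<j j≤k)
        bound : ∀ q → ∃ λ k → S q → q ∈ₗ visited k
        bound q with em {S q}
        ... | no q∉ = 0 , λ q∈ → contradiction q∈ q∉
        ... | yes q∈ with q∈ (suc n₂)
        ...   | suc l , s≤s n₂≤l , eq = suc (l ∸ n₂) , λ _ →
          subst (_∈ₗ visited (suc (l ∸ n₂)))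
            (trans (cong (λ i → ρ ξ (suc i)) (m∸n+n≡m n₂≤l)) eq)
            (∈-applyUpTo⁺ (λ j → ρ ξ (suc (j + n₂))) ≤-refl)

      open import Data.List.Membership.DecPropositional (_≟_ {M.size}) using (_∈?_; _∉?_)

      k₃ n₃ : ℕ
      k₃ = proj₁ allVisited
      n₃ = k₃ + n₂

      n₂≤n₃ : n₂ ≤ n₃
      n₂≤n₃ = m≤n+m n₂ k₃

      -- By time `n₃` all of `S` has been visited since `n₂`, so these entries are exactly the
      -- states outside `S`. They are never moved again.
      tail : List M.Q
      tail = filter (_∉? visited k₃) (recent (σ n₂))

      visited-S : ∀ k {q} → q ∈ₗ visited k → S q
      visited-S k q∈ with ∈-applyUpTo⁻ _ q∈
      ... | j , _ , refl = S-from (≤-trans (n≤1+n n₁) (≤-trans (m≤n+m n₂ j) (n≤1+n _)))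

      S⇔∉tail : ∀ q → S q ⇔ q ∉ tail
      S⇔∉tail q = mk⇔
        (λ q∈S q∈t → proj₂ (∈-filter⁻ (_∉? visited k₃) {xs = recent (σ n₂)} q∈t)
                       (proj₂ allVisited q q∈S))
        outside
        where
        outside : q ∉ tail → S q
        outside q∉t with q ∈? visited k₃
        ... | yes q∈ = visited-S k₃ q∈
        ... | no q∉  = contradiction (∈-filter⁺ (_∉? visited k₃) (complete (σ-inv n₂) q) q∉) q∉t

      ∉tail : ∀ {n} → n₁ ≤ n → ρ ξ n ∉ tail
      ∉tail n₁≤n = to (S⇔∉tail _) (S-from n₁≤n)

      Split : ℕ → Set
      Split n = ∃ λ f → recent (σ n) ≡ f ++ tail × (∀ {q} → q ∈ₗ f → q ∉ tail)

      split-later : ∀ k → Split (k + n₃)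
      split-later zero    = visit [] (visited k₃) ,
        trans (recent-later k₃) (visit-decompose (visited k₃) (recent (σ n₂))) , front
        where
        front : ∀ {q} → q ∈ₗ visit [] (visited k₃) → q ∉ tail
        front q∈ with ∈-visit (visited k₃) {[]} q∈
        ... | inj₁ q∈v = to (S⇔∉tail _) (visited-S k₃ q∈v)
      split-later (suc k) with split-later k
      ... | f , eq , front = moveToFront f q ,
        trans (recent-σ (k + n₃)) (trans (cong (λ l → moveToFront l q) eq)
          (moveToFront-++ f q∉)) ,
        λ { (here refl) → q∉ ; (there r∈) → front (∈-without⁻ f r∈) }
        where
        q : M.Q
        q = ρ ξ (suc (k + n₃))
        q∉ : q ∉ tail
        q∉ = ∉tail (≤-trans (≤-trans (n≤1+n n₁) n₂≤n₃) (≤-trans (m≤n+m n₃ k) (n≤1+n _)))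

      split : ∀ {n} → n₃ ≤ n → Split n
      split {n} n₃≤n = subst Split (m∸n+n≡m n₃≤n) (split-later (n ∸ n₃))

      n₁≤ : ∀ {n} → n₃ ≤ n → n₁ ≤ n
      n₁≤ n₃≤n = ≤-trans (n≤1+n n₁) (≤-trans n₂≤n₃ n₃≤n)

      in-front : ∀ {n f q} → recent (σ n) ≡ f ++ tail → q ∉ tail → q ∈ₗ f
      in-front {n} {f} {q} eq q∉ with ∈-++⁻ f (subst (q ∈ₗ_) eq (complete (σ-inv n) q))
      ... | inj₁ q∈f = q∈f
      ... | inj₂ q∈t = contradiction q∈t q∉

      -- The state visited lies in front of the tail, so the tail remains at the end of what follows
      -- it. Hence all tours from `n₃` on stay within `confine D tail`.
      after-tail : ∀ {n} → n₃ ≤ n → ∃ λ xs → after (ρ ξ (suc n)) (recent (σ n)) ≡ xs ++ tail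
      after-tail {n} n₃≤n with split n₃≤n
      ... | f , eq , _ = after (ρ ξ (suc n)) f , trans (cong (after (ρ ξ (suc n))) eq)
        (after-++ f (in-front {n} eq q∉) q∉)
        where
        q∉ : ρ ξ (suc n) ∉ tail
        q∉ = ∉tail (≤-trans (n₁≤ n₃≤n) (n≤1+n n))

      -- The last entry z in front of the tail keeps its place until M visits it again.
      hitLast : ∀ k {n ys z} → n₃ ≤ n → recent (σ n) ≡ ys ++ z ∷ tail → z ∉ tail →
                ρ ξ (suc (k + n)) ≡ z →
                ∃ λ n′ → n ≤ n′ × after (ρ ξ (suc n′)) (recent (σ n′)) ≡ tail
      hitLast k {n} {ys} {z} n₃≤n eq z∉ visit-z with ρ ξ (suc n) ≟ z
      ... | yes refl = n , ≤-refl , trans (cong (after z) eq) (after-∷ ys z∉)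
      hitLast zero    n₃≤n eq z∉ visit-z | no q≢z = contradiction visit-z q≢z
      hitLast (suc k) {n} {ys} {z} n₃≤n eq z∉ visit-z | no q≢z
        with hitLast k {suc n} {moveToFront ys (ρ ξ (suc n))} (≤-trans n₃≤n (n≤1+n n)) eq′ z∉
               (trans (cong (λ i → ρ ξ (suc i)) (+-suc k n)) visit-z)
        where
        q = ρ ξ (suc n)
        eq′ : recent (σ (suc n)) ≡ moveToFront ys q ++ z ∷ tail
        eq′ = trans (recent-σ n) (trans (cong (λ l → moveToFront l q) eq)
          (moveToFront-++ ys λ { (here q≡z) → q≢z q≡z
                               ; (there q∈) → ∉tail (≤-trans (n₁≤ n₃≤n) (n≤1+n n)) q∈ }))
      ... | n′ , n<n′ , hit = n′ , ≤-trans (n≤1+n n) n<n′ , hit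

      -- The entry just in front of the tail belongs to `S` and is visited again; at that visit
      -- exactly the tail lies behind it, and `N` tours the whole of `T`.
      hits : ∀ {n} → n₃ ≤ n → ∃ λ n′ → n ≤ n′ × after (ρ ξ (suc n′)) (recent (σ n′)) ≡ tail
      hits {n} n₃≤n with split n₃≤n
      ... | f , eq , front with initLast f
      ...   | [] = contradiction (in-front {n} eq (∉tail (n₁≤ n₃≤n))) λ ()
      ...   | ys ∷ʳ′ z with from (S⇔∉tail z) (front (∈-++⁺ʳ ys (here refl))) (suc n)
      ...     | suc l , s≤s n≤l , eq′ = hitLast (l ∸ n) n₃≤n (trans eq (++-assoc ys [ z ] tail))
                (front (∈-++⁺ʳ ys (here refl)))
                (trans (cong (λ i → ρ ξ (suc i)) (m∸n+n≡m n≤l)) eq′)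

      T : Subset N.size
      T = confine D tail

      ∉tail-connected : MR.Connected (_∉ tail)
      ∉tail-connected = MR.connected-resp S⇔∉tail S-connected

      T-minimal : Minimal (_∉ tail) T
      T-minimal = confine-minimal D tail q∉ ∉tail-connected
        -- The complement of the tail is connected and contains the current state, so it lies in the
        -- component for which `D` was chosen.
        (home-win settledHome ∉tail-connected q∉ λ r∉ →
          MR.reach-trans (proj₁ near₂) (MR.connected⇒reach ∉tail-connected q∉ r∉) ,
          MR.reach-trans (MR.connected⇒reach ∉tail-connected r∉ q∉) (proj₂ near₂))
        where
        q∉ : cur (σ n₂) ∉ tail
        q∉ = subst (_∉ tail) (sym (cur-σ n₂)) (∉tail (n≤1+n n₁))
        near₂ : entry (σ n₂) ≈ cur (σ n₂)
        near₂ = near (σ-inv n₂)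

      tour : ∀ {n} → n₂ ≤ n →
        NR.Covers (confine D (after (ρ ξ (suc n)) (recent (σ n)))) (locate (σ n)) (response n) (amount n)
      tour {n} n₂≤n = subst (λ U → NR.Covers U (locate (σ n)) (response n) (amount n))
        (cong₂ (λ E q → confine E (after q (recent (σ n)))) (home-σ n₂≤n) (next-σ n))
        (proj₂ (proj₂ (proj₂ (answers n))) (returns (≤-trans (n≤1+n n₁) n₂≤n)) (settled (stays n₂≤n)))

      length-block : ∀ n → length (response n ↾ amount n) ≡ amount n
      length-block n = length-applyUpTo (response n) (amount n)

      amount-positive : ∀ {n} → n₂ ≤ n → 1 ≤ amount n
      amount-positive {n} n₂≤n with tour n₂≤n
      ... | _ , all with all (proj₂ (confine-nonempty D (minimal-nonempty (Home.minimal settledHome))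
                                             (after (ρ ξ (suc n)) (recent (σ n)))))
      ...   | j , j< , _ = ≤-trans (s≤s z≤n) j<

      longer : ∀ k → k ≤ length (upto (k + n₂))
      longer zero    = z≤n
      longer (suc k) = begin
        suc k                                                           ≡⟨ +-comm 1 k ⟩
        k + 1                                                           ≤⟨ +-mono-≤ (longer k) (amount-positive (m≤n+m n₂ k)) ⟩
        length (upto (k + n₂)) + amount (k + n₂)                        ≡⟨ cong (length (upto (k + n₂)) +_) (length-block (k + n₂)) ⟨
        length (upto (k + n₂)) + length (response (k + n₂) ↾ amount (k + n₂)) ≡⟨ length-upto-suc (k + n₂) ⟨
        length (upto (suc (k + n₂)))                                    ∎
        where open ≤-Reasoning

    unbounded : ∀ l → ∃ λ n → l ≤ length (upto n)
    unbounded l = l + n₂ , longer l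

    image : ωWord m
    image = infinite unbounded

    image-upto : ∀ n → upto n ≡ image ↾ length (upto n)
    image-upto = infinite-↾ unbounded

    private
      image-block : ∀ n → Agree (amount n) (shift (length (upto n)) image) (response n)
      image-block n {j} j< = trans
        (infinite-shift unbounded n (subst (j <_) (sym (length-block n)) j<))
        (nth-prefix letter (response n) j<)

      run-block : ∀ n {j} → NR.run N.init image (length (upto n)) ≡ locate (σ n) → j ≤ amount n →
                  NR.run N.init image (length (upto n) + j) ≡ NR.run (locate (σ n)) (response n) j
      run-block n {j} at j≤ = trans (NR.run-shift N.init image (length (upto n)) j)
        (trans (cong (λ v → NR.run v (shift (length (upto n)) image) j) at)
               (NR.run-agree (image-block n) (locate (σ n)) j≤))

      run-upto : ∀ n → NR.run N.init image (length (upto n)) ≡ locate (σ n)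
      run-upto zero    = sym (cong locate σ-zero)
      run-upto (suc n) = begin
        NR.run N.init image (length (upto (suc n)))
          ≡⟨ cong (NR.run N.init image)
               (trans (length-upto-suc n) (cong (length (upto n) +_) (length-block n))) ⟩
        NR.run N.init image (length (upto n) + amount n)
          ≡⟨ run-block n (run-upto n) ≤-refl ⟩
        NR.run (locate (σ n)) (response n) (amount n)
          ≡⟨ proj₁ (proj₂ (proj₂ (answers n))) ⟩
        locate (step (σ n) (ξ n))
          ≡⟨ cong locate (σ-suc n) ⟨
        locate (σ (suc n)) ∎
        where open ≡-Reasoning

    -- By `hits`, infinitely many tours cover exactly `T`; by `after-tail`, every position past the
    -- first `n₃` blocks falls into a tour inside `T`.
    image-recurs : ∀ v → v ∈ₛ T ⇔ Recurs (NR.run N.init image) v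
    image-recurs v = mk⇔ recurs inside
      where
      recurs : v ∈ₛ T → Recurs (NR.run N.init image) v
      recurs v∈ k with hits (m≤n+m n₃ k)
      ... | n , kn₃≤n , hit with tour (≤-trans n₂≤n₃ (≤-trans (m≤n+m n₃ k) kn₃≤n))
      ...   | _ , all with all (subst (λ t → v ∈ₛ confine D t) (sym hit) v∈)
      ...     | j , j< , eq = length (upto n) + suc j ,
        ≤-trans (≤-trans (longer k) (length-≤ (≤-trans (+-monoʳ-≤ k n₂≤n₃) kn₃≤n))) (m≤m+n _ _) ,
        trans (run-block n (run-upto n) j<) eq
        where
        length-≤ : ∀ {a b} → a ≤ b → length (upto a) ≤ length (upto b)
        length-≤ {a} {b} a≤b = subst (λ i → length (upto a) ≤ length (upto i)) (m∸n+n≡m a≤b)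
          (length-upto-mono a (b ∸ a))
      inside : Recurs (NR.run N.init image) v → v ∈ₛ T
      inside r with r (length (upto n₃))
      ... | l , n₃≤l , refl with block unbounded n₃ n₃≤l
      ...   | n , n₃≤n , n≤l , l≤n with tour (≤-trans n₂≤n₃ n₃≤n) | after-tail n₃≤n
      ...     | within , _ | xs , eq = confine-++ D xs
        (subst (λ t → NR.run N.init image l ∈ₛ confine D t) eq
          (subst (λ i → NR.run N.init image i ∈ₛ confine D (after (ρ ξ (suc n)) (recent (σ n))))
            (m+[n∸m]≡n n≤l)
            (subst (_∈ₛ confine D (after (ρ ξ (suc n)) (recent (σ n))))
              (sym (run-block n (run-upto n) part)) (within part))))
        where
        part : l ∸ length (upto n) ≤ amount n
        part = m≤n+o⇒m∸n≤o l (length (upto n))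
          (subst (l ≤_) (trans (length-upto-suc n) (cong (length (upto n) +_) (length-block n))) l≤n)

    -- `link` supplies an input with the limit set of `ξ` in `M` whose image under `h` has limit set
    -- `T` in `N`. The output of the transducer has that limit set too.
    image-linked : ∃ λ ξ′ → SameLimit M ξ ξ′ × (∀ v → Recurs (ν ξ′) v ⇔ Recurs (NR.run N.init image) v)
    image-linked with link ∉tail-connected T-minimal
    ... | ξ′ , limitᴹ , limitᴺ = ξ′ ,
      (λ q → mk⇔ (to (limitᴹ q) ∘ to (S⇔∉tail q)) (from (S⇔∉tail q) ∘ from (limitᴹ q))) ,
      (λ v → mk⇔ (to (image-recurs v) ∘ from (limitᴺ v)) (to (limitᴺ v) ∘ from (image-recurs v)))

  -- Assembling the transducer

  transducer : Transducer m
  transducer = record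
    { automaton = R.automaton
    ; g = λ i x → let ζ , l , _ = answer (R.decode-inv i) x in ζ ↾ l }

  transducer-aperiodic : M.Aperiodic → Transducer.Aperiodic transducer
  transducer-aperiodic aperiodic = R.realize-aperiodic (step-aperiodic aperiodic)

  private
    module K = Automaton R.automaton

  module _ (ξ : ωWord m) where
    private
      κ : ℕ → K.Q
      κ n = K.δ* K.init (ξ ↾ n)

      κ-suc : ∀ n → κ (suc n) ≡ K.δ (κ n) (ξ n)
      κ-suc n = trans (cong (K.δ* K.init) (sym (applyUpTo-∷ʳ ξ n)))
                      (foldl-∷ʳ K.δ K.init (ξ n) (ξ ↾ n))

    module P = Play ξ (λ n → R.decode (κ n)) (λ n → R.decode-inv (κ n)) R.decode-init
      (λ n → trans (cong R.decode (κ-suc n)) (R.decode-δ (κ n) (ξ n)))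
      (λ n → answer (R.decode-inv (κ n)) (ξ n))

  transducer-computes : Transducer.Computes transducer P.image
  transducer-computes ξ = P.image-upto ξ , P.unbounded ξ

  abstract
    strategy : ∃ λ (T : Transducer m) → ∃ λ g → Transducer.Computes T g
      × (∀ ξ → ∃ λ ξ′ → SameLimit M ξ ξ′ × SameLimit N (h ξ′) (g ξ))
      × (M.Aperiodic → Transducer.Aperiodic T)
    strategy = transducer , P.image , transducer-computes , P.image-linked , transducer-aperiodic

-- Products of automata

module _ (em : ExcludedMiddle 0ℓ) {m} (P M : Automaton m)
  (π : Automaton.Q P → Automaton.Q M)
  (π-δ : ∀ q x → π (Automaton.δ P q x) ≡ Automaton.δ M (π q) x)
  (π-init : π (Automaton.init P) ≡ Automaton.init M) where
  private
    module P = Automaton P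
    module M = Automaton M

  π-run : ∀ ξ n → π (Run.run P P.init ξ n) ≡ Run.run M M.init ξ n
  π-run ξ zero    = π-init
  π-run ξ (suc n) = trans (π-δ _ _) (cong (λ q → M.δ q (ξ n)) (π-run ξ n))

  π-δ* : ∀ q u → π (P.δ* q u) ≡ M.δ* (π q) u
  π-δ* q []      = refl
  π-δ* q (x ∷ u) = trans (π-δ* (P.δ q x) u) (cong (λ r → M.δ* r u) (π-δ q x))

  private
    transfer : ∀ {ξ η} → SameLimit P ξ η → ∀ {q} →
               Recurs (Run.run M M.init ξ) q → Recurs (Run.run M M.init η) q
    transfer {ξ} {η} same r k
      with Classical.eventuallyRecurrent em (Run.run P P.init ξ)
    ... | N , recurs with r N
    ...   | l , N≤l , refl with to (same _) (recurs N≤l) k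
    ...     | l′ , k≤l′ , eq = l′ , k≤l′ ,
      trans (sym (π-run η l′)) (trans (cong π eq) (π-run ξ l))

  -- A recurring state of `M` is the image of a recurring state of `P`: late enough, every state on
  -- the run of `P` recurs, so any late visit can be lifted.
  sameLimit-image : ∀ {ξ η} → SameLimit P ξ η → SameLimit M ξ η
  sameLimit-image same q = mk⇔ (transfer same)
    (transfer (λ r → mk⇔ (from (same r)) (to (same r))))

module _ {m} (M M′ : Automaton m) where
  private
    module M = Automaton M
    module M′ = Automaton M′

  left : Fin (M.size * M′.size) → M.Q
  left i = proj₁ (remQuot M′.size i)

  right : Fin (M.size * M′.size) → M′.Q
  right i = proj₂ (remQuot {M.size} M′.size i)

  pair : Automaton m
  pair = record
    { size = M.size * M′.size
    ; δ    = λ i x → combine (M.δ (left i) x) (M′.δ (right i) x)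
    ; init = combine M.init M′.init }

  left-combine : ∀ (q : M.Q) (q′ : M′.Q) → left (combine q q′) ≡ q
  left-combine q q′ = cong proj₁ (remQuot-combine q q′)

  right-combine : ∀ (q : M.Q) (q′ : M′.Q) → right (combine q q′) ≡ q′
  right-combine q q′ = cong proj₂ (remQuot-combine q q′)

  pair-≡ : ∀ {i j} → left i ≡ left j → right i ≡ right j → i ≡ j
  pair-≡ {i} {j} l r = trans (sym (combine-remQuot {M.size} M′.size i))
    (trans (cong₂ combine l r) (combine-remQuot {M.size} M′.size j))

  pair-aperiodic : ExcludedMiddle 0ℓ → M.Aperiodic → M′.Aperiodic → Automaton.Aperiodic pair
  pair-aperiodic em a a′ i u n u≢[] 0<n eq = pair-≡
    (trans (leftδ* i u) (a _ u n u≢[] 0<n (trans (sym (leftδ* i uⁿ)) (cong left eq))))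
    (trans (rightδ* i u) (a′ _ u n u≢[] 0<n (trans (sym (rightδ* i uⁿ)) (cong right eq))))
    where
    uⁿ = concat (replicate n u)
    leftδ* = π-δ* em pair M left (λ q x → left-combine _ _) (left-combine _ _)
    rightδ* = π-δ* em pair M′ right (λ q x → right-combine (M.δ (left q) x) _) (right-combine M.init _)

module _ (em : ExcludedMiddle 0ℓ) {m : ℕ} where

  product : ∀ k (Ms : Fin k → Automaton m) → ∃ λ P →
    ((∀ i → Automaton.Aperiodic (Ms i)) → Automaton.Aperiodic P)
    × (∀ i {ξ η} → SameLimit P ξ η → SameLimit (Ms i) ξ η)
  product zero    Ms = record { size = 1 ; δ = λ q _ → q ; init = zero } ,
    (λ _ → λ { zero u n _ _ _ → still u }) , λ ()
    where
    still : ∀ u → foldl (λ q _ → q) (zero {0}) u ≡ zero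
    still []      = refl
    still (_ ∷ u) = still u
  product (suc k) Ms with product k (Ms ∘ suc)
  ... | P , aperiodic , same = pair (Ms zero) P ,
    (λ as → pair-aperiodic (Ms zero) P em (as zero) (aperiodic (as ∘ suc))) ,
    λ { zero s → sameLimit-image em (pair (Ms zero) P) (Ms zero) (left (Ms zero) P)
                   (λ q x → left-combine (Ms zero) P _ _) (left-combine (Ms zero) P _ _) s
      ; (suc i) s → same i (sameLimit-image em (pair (Ms zero) P) P (right (Ms zero) P)
                   (λ q x → right-combine (Ms zero) P (Automaton.δ (Ms zero) (left (Ms zero) P q) x) _)
                   (right-combine (Ms zero) P (Automaton.init (Ms zero)) _) s) }

  recognizes-limit : ∀ (M : Automaton m) {L} → Recognizes M L → ∀ {ξ η} → SameLimit M ξ η → L ξ → L η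
  recognizes-limit M (F , recognizes) {ξ} {η} same ξ∈L with to (recognizes ξ) ξ∈L
  ... | S , limit , S∈F = from (recognizes η)
    (S , (λ q → mk⇔ (from (recurs-run M η q) ∘ to (same q) ∘ to (recurs-run M ξ q) ∘ to (limit q))
                    (from (limit q) ∘ from (recurs-run M ξ q) ∘ from (same q) ∘ to (recurs-run M η q)))
       , S∈F)

  Determines : ∀ {k} → Automaton m → Partition m k → Set
  Determines M A = ∀ {ξ η} → SameLimit M ξ η → A ξ ≡ A η

  determining : ∀ {k} (A : Partition m k) (regular : A ∈ 𝓡) → ∃ λ M → Determines M A
    × ((∀ i → Automaton.Aperiodic (proj₁ (regular i))) → Automaton.Aperiodic M)
  determining {k} A regular with product k (proj₁ ∘ regular)
  ... | P , aperiodic , same = P ,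
    -- The automaton for the value `A ξ` accepts `ξ`, hence also every word with the same limit set,
    -- which therefore has this value too.
    (λ {ξ} s → sym (recognizes-limit _ (proj₂ (regular (A ξ))) (same (A ξ) s) refl)) , aperiodic

-- Continuous functions

-- Continuity is applied to the cylinder of length `l` around `h ξ`.
continuous⇒modulus : ∀ {m} {h : ωWord m → ωWord m} → Continuous h →
  ∀ ξ l → ∃ λ n → ∀ {η} → Agree n ξ η → Agree l (h ξ) (h η)
continuous⇒modulus {h = h} continuous ξ l
  with continuous (λ η → η ↾ l ≡ h ξ ↾ l) (λ _ η∈ → l , λ _ eq → trans eq η∈) ξ refl
... | n , near = n , λ {η} a → ↾⇒agree l (sym (near η (sym (agree⇒↾ n a))))

-- The output after `l` letters depends only on these letters, and for suitable `l` it is long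
-- enough to decide membership in the open set.
computes⇒continuous : ∀ {m} (T : Transducer m) {h} → Transducer.Computes T h → Continuous h
computes⇒continuous T {h} computes U open-U ξ hξ∈U with open-U (h ξ) hξ∈U
... | n , near with proj₂ (computes ξ) n
...   | l , n≤ = l , λ η eq → near (h η) (agree⇒↾ n (agree-≤ n≤ (agreement η (↾⇒agree l eq))))
  where
  open Transducer T
  output-agree : ∀ {η} → Agree l η ξ → output η l ≡ output ξ l
  output-agree {η} a = cong concat (agree⇒applyUpTo l ≤-refl)
    where
    f : ωWord _ → ℕ → Word _
    f ζ j = g (δ* init (ζ ↾ j)) (ζ j)
    agree⇒applyUpTo : ∀ k → k ≤ l → applyUpTo (f η) k ≡ applyUpTo (f ξ) k
    agree⇒applyUpTo zero    _   = refl
    agree⇒applyUpTo (suc k) k<l = trans (sym (applyUpTo-∷ʳ (f η) k))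
      (trans (cong₂ _∷ʳ_ (agree⇒applyUpTo k (<⇒≤ k<l))
               (cong₂ (λ u x → g (δ* init u) x) (agree⇒↾ k (agree-≤ (<⇒≤ k<l) a)) (a k<l)))
             (applyUpTo-∷ʳ (f ξ) k))
  agreement : ∀ η → Agree l η ξ → Agree (length (output ξ l)) (h η) (h ξ)
  agreement η a = ↾⇒agree (length (output ξ l)) (begin
    h η ↾ length (output ξ l)  ≡⟨ cong (λ w → h η ↾ length w) (output-agree a) ⟨
    h η ↾ length (output η l)  ≡⟨ proj₁ (computes η) l ⟨
    output η l                 ≡⟨ output-agree a ⟩
    output ξ l                 ≡⟨ proj₁ (computes ξ) l ⟩
    h ξ ↾ length (output ξ l)  ∎)
    where open ≡-Reasoning

-- From strategies to reductions

module _ (em : ExcludedMiddle 0ℓ) {m k : ℕ} (letter : Fin m) {A B : Partition m k} where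

  synthesize : (regularᴬ : A ∈ 𝓡) → B ∈ 𝓡 → A ≤CA B → ∃ λ (T : Transducer m) → ∃ λ h →
    Transducer.Computes T h × A ≗ B ∘ h
    × ((∀ i → Automaton.Aperiodic (proj₁ (regularᴬ i))) → Transducer.Aperiodic T)
  synthesize regularᴬ regularᴮ (h , continuous , A≗B∘h)
    with determining em A regularᴬ | determining em B regularᴮ
  ... | M , determinesᴬ , aperiodic | N , determinesᴮ , _
    with Strategy.strategy em M N h (continuous⇒modulus continuous) letter
  ...   | T , g , computes , same , aperiodicᵀ = T , g , computes , correct , aperiodicᵀ ∘ aperiodic
    where
    correct : A ≗ B ∘ g
    correct ξ with same ξ
    -- The chain is `A ξ`, `A ξ′`, `B (h ξ′)`, `B (g ξ)`: the given reduction is used only at the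
    -- input `ξ′`.
    ... | ξ′ , sameᴹ , sameᴺ = trans (determinesᴬ sameᴹ) (trans (A≗B∘h ξ′) (determinesᴮ sameᴺ))

theorem4p13 : ExcludedMiddle 0ℓ → (m k : ℕ) → 2 ≤ m → 2 ≤ k →
    ((A B : Partition m k) → A ∈ 𝓡 → B ∈ 𝓡 → (A ≤CA B ⇔ A ≤DA B))
    × ((A B : Partition m k) → A ∈ 𝓐 → B ∈ 𝓐 → (A ≤CA B ⇔ A ≤AA B))
theorem4p13 em m k 2≤m _ =
  (λ A B regularᴬ regularᴮ → mk⇔
    (λ A≤B → let T , h , computes , eq , _ = synthesize em letter regularᴬ regularᴮ A≤B
             in h , (T , computes) , eq)
    (λ { (h , (T , computes) , eq) → h , computes⇒continuous T computes , eq })) ,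
  (λ A B aperiodicᴬ aperiodicᴮ → mk⇔
    (λ A≤B → let T , h , computes , eq , aperiodic =
                   synthesize em letter (regular aperiodicᴬ) (regular aperiodicᴮ) A≤B
             in h , (T , aperiodic (λ i → proj₁ (proj₂ (aperiodicᴬ i))) , computes) , eq)
    (λ { (h , (T , _ , computes) , eq) → h , computes⇒continuous T computes , eq }))
  where
  letter : Fin m
  letter = fromℕ< (≤-trans (s≤s z≤n) 2≤m)
  regular : ∀ {A : Partition m k} → A ∈ 𝓐 → A ∈ 𝓡
  regular aperiodic i = let M , _ , recognizes = aperiodic i in M , recognizes
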